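{- Let $m\ge 1$. Any product two-action game with $m$ players whose characteristic tuple is $(\underline v,\sigma^1,\dots,\sigma^m)=((0,\dots,0),\delta^1,\dots,\delta^m)$ is maximal; that is, for every $\pi\in S_m\setminus\mathrm{Der}_m$, exactly half of the elements of $EC(\pi)$ are Nash equilibria. (Such games exist for every $m$: choose $v_i=0$ and numbers $a^i_j\in(0,1)$ ordered according to $\delta^j$, and e.g. $U^i(s^i_0,\cdot)=0$, with $V^i$ the multilinear map $\gamma^i\prod_{j\neq i}(\gamma^j-a^i_j)$.)
   Context: Fix an integer $m\ge 1$ and $\mathcal A=\{1,\dots,m\}$. A two-action game is a finite game in normal form with player set $\mathcal A$ in which each player $i$ has exactly two pure strategies $s^i_0,s^i_1$, together with utility functions $U^i:S\to\mathbb R$, where $S=\prod_{i\in\mathcal A}\{s^i_0,s^i_1\}$. A mixed strategy combination is identified with $\underline\gamma=(\gamma^1,\dots,\gamma^m)\in[0,1]^m$, where $\gamma^i$ is the probability with which player $i$ plays $s^i_1$. The expected utility $V^i$ is the multilinear extension $V^i(\underline\gamma)=\sum_{(j_1,\dots,j_m)\in\{0,1\}^m}\prod_{k=1}^m p_k(j_k)\,U^i(s^1_{j_1},\dots,s^m_{j_m})$ with $p_k(1)=\gamma^k$, $p_k(0)=1-\gamma^k$. Write $\underline\gamma^{ -i}=(\gamma^j)_{j\ne i}$ and $\lambda^i(\underline\gamma^{ -i}):=V^i(\underline\gamma)|_{\gamma^i=1}-V^i(\underline\gamma)|_{\gamma^i=0}$. A Nash equilibrium is a point $\underline\gamma\in[0,1]^m$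 such that for every $i$: $\lambda^i(\underline\gamma^{ -i})=0$ if $0<\gamma^i<1$; $\lambda^i(\underline\gamma^{ -i})\le 0$ if $\gamma^i=0$; $\lambda^i(\underline\gamma^{ -i})\ge 0$ if $\gamma^i=1$. For $\underline\gamma$ put $L(\underline\gamma)=\{i:\gamma^i\in\{0,1\}\}$. A two-action game is a product two-action game if there exist $\underline v=(v_1,\dots,v_m)\in\{0,1\}^m$ and numbers $a^i_j\in(0,1)$ for $i,j\in\mathcal A$, $i\ne j$, with $a^{i_1}_j\neq a^{i_2}_j$ whenever $i_1\neq i_2$ and both differ from $j$, such that $\lambda^i(\underline\gamma^{ -i})=(-1)^{v_i}\prod_{j\in\mathcal A\setminus\{i\}}(\gamma^j-a^i_j)$ for every $i\in\mathcal A$. For $j\in\mathcal A$ the $j$-th associated permutation $\sigma^j\in S_m$ is the unique permutation with $\sigma^j(j)=j$ such that for $i,i'\in\mathcal A\setminus\{j\}$ one has $\sigma^j(i)<\sigma^j(i')$ iff $a^i_j>a^{i'}_j$. The tuple $(\underline v,\sigma^1,\dots,\sigma^m)$ is the characteristic tuple. For $\pi\in S_m$, $F(\pi)=\{i:\pi(i)=i\}$; $\mathrm{Der}_m=\{\pi\in S_m: F(\pi)=\emptyset\}$; $EC(\pi):=\{\underline\gamma\in[0,1]^m \mid L(\underline\gamma)=F(\pi),\ \gamma^j=a^{\pi(j)}_j \text{ for all } j\notin F(\pi)\}$. A product two-action game is maximal if for every $\pi\in S_m\setminus\mathrm{Der}_m$ exactly half of the elements of $EC(\pi)$ are Nash equilibria.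 For $j\in\mathcal A$, $\delta^j\in S_m$ is the unique permutation with $\delta^j(j)=j$ such that for all $k_1<k_2$ in $\mathcal A\setminus\{j\}$ one has $\delta^j(k_1)>\delta^j(k_2)$ iff $k_1<j<k_2$. -}

module Defs where

import Algebra.Properties.CommutativeSemigroup as CommutativeSemigroupProperties
import Algebra.Properties.Group as GroupProperties
open import Algebra.Bundles using (module CommutativeMonoid)
open import Data.Bool.Base using (if_then_else_)
open import Data.Fin.Base as Fin using (Fin; zero; suc)
open import Data.Fin.Permutation using (Permutation′; _⟨$⟩ʳ_)
open import Data.Fin.Properties as Finₚ using ()
open import Data.Nat.Base as ℕ using (ℕ; zero; suc)
open import Data.Nat.Properties as ℕₚ using ()
open import Data.Product.Base using (_×_; _,_; ∃-syntax; proj₁; proj₂)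
open import Data.Rational as ℚ using (ℚ; 0ℚ; 1ℚ; ½)
open import Data.Rational.Properties as ℚₚ using ()
open import Data.Sum.Base using (_⊎_)
open import Data.Vec.Base using (Vec; []; _∷_; lookup)
open import Data.Vec.Functional using (Vector; foldr; updateAt)
import Data.Vec.Functional.Relation.Binary.Pointwise.Properties as Pointwise
open import Function.Base using (const; _∘_)
open import Function.Bundles using (Bijection; _⇔_)
open import Level using (0ℓ)
open import Relation.Binary.Bundles using (Setoid)
import Relation.Binary.Construct.On as On
open import Relation.Binary.PropositionalEquality using (_≡_; _≢_; refl; sym; trans; cong; cong₂; subst; setoid)
open import Relation.Nullary.Decidable using (does)
open import Relation.Nullary.Negation using (¬_)
open import Relation.Unary using (Pred; _∩_)

------------------------------------------------------------------------
-- Real numbers: Cauchy sequences of rationals.  _≈_ is the equality of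
-- reals, so subsets of ℝ and ℝᵐ are counted up to _≈_.

Eventually : Pred ℕ 0ℓ → Set
Eventually P = ∃[ N ] (∀ n → N ℕ.≤ n → P n)

IsCauchy : (ℕ → ℚ) → Set
IsCauchy s = ∀ ε → 0ℚ ℚ.< ε →
  ∃[ N ] (∀ k n → N ℕ.≤ k → N ℕ.≤ n → ℚ.∣ s k ℚ.- s n ∣ ℚ.< ε)

record ℝ : Set where
  constructor mkℝ
  field
    seq      : ℕ → ℚ
    isCauchy : IsCauchy seq

open ℝ public

module CauchyLemmas where

  private
    module ℚGroup = GroupProperties ℚₚ.+-0-group
    module ℚSemigroup = CommutativeSemigroupProperties (CommutativeMonoid.commutativeSemigroup ℚₚ.+-0-commutativeMonoid)

  halves : ∀ p → p ℚ.* ½ ℚ.+ p ℚ.* ½ ≡ p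
  halves p = trans (sym (ℚₚ.*-distribˡ-+ p ½ ½)) (ℚₚ.*-identityʳ p)

  *-pos : ∀ {p q} → 0ℚ ℚ.< p → 0ℚ ℚ.< q → 0ℚ ℚ.< p ℚ.* q
  *-pos {p} {q} 0<p 0<q = subst (ℚ._< p ℚ.* q) (ℚₚ.*-zeroʳ p)
    (ℚₚ.*-monoʳ-<-pos p {{ℚ.positive 0<p}} 0<q)

  half-pos : ∀ {ε} → 0ℚ ℚ.< ε → 0ℚ ℚ.< ε ℚ.* ½
  half-pos 0<ε = *-pos 0<ε (ℚₚ.positive⁻¹ ½)

  cancel : ∀ p q → (p ℚ.- q) ℚ.+ q ≡ p
  cancel p q = trans (ℚₚ.+-assoc p (ℚ.- q) q)
    (trans (cong (p ℚ.+_) (ℚₚ.+-inverseˡ q)) (ℚₚ.+-identityʳ p))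

  telescope : ∀ p q r → p ℚ.- r ≡ (p ℚ.- q) ℚ.+ (q ℚ.- r)
  telescope p q r = trans (cong (ℚ._- r) (sym (cancel p q)))
    (ℚₚ.+-assoc (p ℚ.- q) q (ℚ.- r))

  neg-sub : ∀ p q → ℚ.- (p ℚ.- q) ≡ q ℚ.- p
  neg-sub = ℚGroup.⁻¹-anti-homo-//

  +-sub-+ : ∀ p q r s → (p ℚ.+ q) ℚ.- (r ℚ.+ s) ≡ (p ℚ.- r) ℚ.+ (q ℚ.- s)
  +-sub-+ p q r s = trans (cong ((p ℚ.+ q) ℚ.+_) (ℚₚ.neg-distrib-+ r s))
    (ℚSemigroup.interchange p q (ℚ.- r) (ℚ.- s))

  *-distribˡ-sub : ∀ p q r → p ℚ.* (q ℚ.- r) ≡ p ℚ.* q ℚ.- p ℚ.* r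
  *-distribˡ-sub p q r = trans (ℚₚ.*-distribˡ-+ p q (ℚ.- r))
    (cong (p ℚ.* q ℚ.+_) (sym (ℚₚ.neg-distribʳ-* p r)))

  *-sub-* : ∀ p q r s → p ℚ.* q ℚ.- r ℚ.* s ≡ p ℚ.* (q ℚ.- s) ℚ.+ s ℚ.* (p ℚ.- r)
  *-sub-* p q r s = trans (telescope (p ℚ.* q) (p ℚ.* s) (r ℚ.* s))
    (cong₂ ℚ._+_ (sym (*-distribˡ-sub p q s))
      (trans (cong₂ ℚ._-_ (ℚₚ.*-comm p s) (ℚₚ.*-comm r s)) (sym (*-distribˡ-sub s p r))))

  ∣-∣-self : ∀ p → ℚ.∣ p ℚ.- p ∣ ≡ 0ℚ
  ∣-∣-self p = cong ℚ.∣_∣ (ℚₚ.+-inverseʳ p)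

  ∣-∣-comm : ∀ p q → ℚ.∣ p ℚ.- q ∣ ≡ ℚ.∣ q ℚ.- p ∣
  ∣-∣-comm p q = trans (cong ℚ.∣_∣ (sym (neg-sub q p))) (ℚₚ.∣-p∣≡∣p∣ (q ℚ.- p))

  splitε : ∀ {ε} p q r → p ≡ q ℚ.+ r →
           ℚ.∣ q ∣ ℚ.< ε ℚ.* ½ → ℚ.∣ r ∣ ℚ.< ε ℚ.* ½ → ℚ.∣ p ∣ ℚ.< ε
  splitε {ε} .(q ℚ.+ r) q r refl q< r< = ℚₚ.≤-<-trans (ℚₚ.∣p+q∣≤∣p∣+∣q∣ q r)
    (subst (ℚ.∣ q ∣ ℚ.+ ℚ.∣ r ∣ ℚ.<_) (halves ε) (ℚₚ.+-mono-< q< r<))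

  bounded : ∀ s → IsCauchy s →
            ∃[ B ] (0ℚ ℚ.< B × Eventually (λ n → ℚ.∣ s n ∣ ℚ.≤ B))
  bounded s c with c 1ℚ (ℚₚ.positive⁻¹ 1ℚ)
  ... | N , close = 1ℚ ℚ.+ ℚ.∣ s N ∣
    , ℚₚ.+-mono-<-≤ (ℚₚ.positive⁻¹ 1ℚ) (ℚₚ.0≤∣p∣ (s N))
    , N , λ n N≤n → subst (λ p → ℚ.∣ p ∣ ℚ.≤ 1ℚ ℚ.+ ℚ.∣ s N ∣) (cancel (s n) (s N))
        (ℚₚ.≤-trans (ℚₚ.∣p+q∣≤∣p∣+∣q∣ (s n ℚ.- s N) (s N))
          (ℚₚ.+-monoˡ-≤ ℚ.∣ s N ∣ (ℚₚ.<⇒≤ (close n N N≤n ℕₚ.≤-refl))))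

  scale : ∀ {B ε} → 0ℚ ℚ.< B → 0ℚ ℚ.< ε →
          ∃[ η ] (0ℚ ℚ.< η × B ℚ.* η ≡ ε)
  scale {B} {ε} 0<B 0<ε = (ℚ.1/ B) ℚ.* ε , *-pos 0<1/B 0<ε
    , trans (sym (ℚₚ.*-assoc B (ℚ.1/ B) ε))
        (trans (cong (ℚ._* ε) (ℚₚ.*-inverseʳ B)) (ℚₚ.*-identityˡ ε))
    where
    instance
      B-pos : ℚ.Positive B
      B-pos = ℚ.positive 0<B
      B-nz : ℚ.NonZero B
      B-nz = ℚₚ.pos⇒nonZero B
    0<1/B : 0ℚ ℚ.< ℚ.1/ B
    0<1/B = ℚₚ.positive⁻¹ (ℚ.1/ B) {{ℚₚ.1/pos⇒pos B}}

  ∣*∣-bound : ∀ {B C η} p q → 0ℚ ℚ.< C → ℚ.∣ p ∣ ℚ.≤ B → B ℚ.≤ C →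
              ℚ.∣ q ∣ ℚ.< η → ℚ.∣ p ℚ.* q ∣ ℚ.< C ℚ.* η
  ∣*∣-bound {B} {C} {η} p q 0<C p≤B B≤C q<η =
    subst (ℚ._< C ℚ.* η) (sym (ℚₚ.∣p*q∣≡∣p∣*∣q∣ p q))
      (ℚₚ.≤-<-trans
        (ℚₚ.*-monoʳ-≤-nonNeg ℚ.∣ q ∣ {{ℚ.nonNegative (ℚₚ.0≤∣p∣ q)}} (ℚₚ.≤-trans p≤B B≤C))
        (ℚₚ.*-monoʳ-<-pos C {{ℚ.positive 0<C}} q<η))

  const-cauchy : ∀ q → IsCauchy (const q)
  const-cauchy q ε 0<ε = 0 , λ _ _ _ _ → subst (ℚ._< ε) (sym (∣-∣-self q)) 0<ε

  +-cauchy : ∀ s t → IsCauchy s → IsCauchy t → IsCauchy (λ n → s n ℚ.+ t n)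
  +-cauchy s t cs ct ε 0<ε with cs (ε ℚ.* ½) (half-pos 0<ε) | ct (ε ℚ.* ½) (half-pos 0<ε)
  ... | M , s-close | N , t-close = M ℕ.⊔ N , λ k n ≤k ≤n →
    splitε ((s k ℚ.+ t k) ℚ.- (s n ℚ.+ t n)) (s k ℚ.- s n) (t k ℚ.- t n) (+-sub-+ (s k) (t k) (s n) (t n))
      (s-close k n (ℕₚ.m⊔n≤o⇒m≤o M N ≤k) (ℕₚ.m⊔n≤o⇒m≤o M N ≤n))
      (t-close k n (ℕₚ.m⊔n≤o⇒n≤o M N ≤k) (ℕₚ.m⊔n≤o⇒n≤o M N ≤n))

  neg-cauchy : ∀ s → IsCauchy s → IsCauchy (λ n → ℚ.- s n)
  neg-cauchy s cs ε 0<ε with cs ε 0<ε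
  ... | N , close = N , λ k n ≤k ≤n →
    subst (ℚ._< ε) (sym (trans (cong ℚ.∣_∣ (sym (ℚₚ.neg-distrib-+ (s k) (ℚ.- s n)))) (ℚₚ.∣-p∣≡∣p∣ (s k ℚ.- s n))))
      (close k n ≤k ≤n)

  *-cauchy : ∀ s t → IsCauchy s → IsCauchy t → IsCauchy (λ n → s n ℚ.* t n)
  *-cauchy s t cs ct ε 0<ε = (M ℕ.⊔ N) ℕ.⊔ (K ℕ.⊔ L) , close
    where
    s-bounded = bounded s cs
    t-bounded = bounded t ct
    B C : ℚ
    B = proj₁ s-bounded
    C = proj₁ t-bounded
    0<B : 0ℚ ℚ.< B
    0<B = proj₁ (proj₂ s-bounded)
    0<C : 0ℚ ℚ.< C
    0<C = proj₁ (proj₂ t-bounded)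
    M N : ℕ
    M = proj₁ (proj₂ (proj₂ s-bounded))
    N = proj₁ (proj₂ (proj₂ t-bounded))
    s≤B : ∀ n → M ℕ.≤ n → ℚ.∣ s n ∣ ℚ.≤ B
    s≤B = proj₂ (proj₂ (proj₂ s-bounded))
    t≤C : ∀ n → N ℕ.≤ n → ℚ.∣ t n ∣ ℚ.≤ C
    t≤C = proj₂ (proj₂ (proj₂ t-bounded))
    0<B+C : 0ℚ ℚ.< B ℚ.+ C
    0<B+C = ℚₚ.+-mono-< 0<B 0<C
    scaled : ∃[ η ] (0ℚ ℚ.< η × (B ℚ.+ C) ℚ.* η ≡ ε ℚ.* ½)
    scaled = scale {B ℚ.+ C} {ε ℚ.* ½} 0<B+C (half-pos {ε} 0<ε)
    η : ℚ
    η = proj₁ scaled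
    0<η : 0ℚ ℚ.< η
    0<η = proj₁ (proj₂ scaled)
    eqη : (B ℚ.+ C) ℚ.* η ≡ ε ℚ.* ½
    eqη = proj₂ (proj₂ scaled)
    K L : ℕ
    K = proj₁ (cs η 0<η)
    L = proj₁ (ct η 0<η)
    s-close : ∀ k n → K ℕ.≤ k → K ℕ.≤ n → ℚ.∣ s k ℚ.- s n ∣ ℚ.< η
    s-close = proj₂ (cs η 0<η)
    t-close : ∀ k n → L ℕ.≤ k → L ℕ.≤ n → ℚ.∣ t k ℚ.- t n ∣ ℚ.< η
    t-close = proj₂ (ct η 0<η)
    B≤B+C : B ℚ.≤ B ℚ.+ C
    B≤B+C = subst (ℚ._≤ B ℚ.+ C) (ℚₚ.+-identityʳ B) (ℚₚ.+-monoʳ-≤ B (ℚₚ.<⇒≤ 0<C))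
    C≤B+C : C ℚ.≤ B ℚ.+ C
    C≤B+C = subst (ℚ._≤ B ℚ.+ C) (ℚₚ.+-identityˡ C) (ℚₚ.+-monoˡ-≤ C (ℚₚ.<⇒≤ 0<B))
    bound : ∀ {D} p q → ℚ.∣ p ∣ ℚ.≤ D → D ℚ.≤ B ℚ.+ C → ℚ.∣ q ∣ ℚ.< η →
            ℚ.∣ p ℚ.* q ∣ ℚ.< ε ℚ.* ½
    bound {D} p q p≤D D≤B+C q<η = subst (ℚ.∣ p ℚ.* q ∣ ℚ.<_) eqη
      (∣*∣-bound {D} {B ℚ.+ C} {η} p q 0<B+C p≤D D≤B+C q<η)
    close : ∀ k n → (M ℕ.⊔ N) ℕ.⊔ (K ℕ.⊔ L) ℕ.≤ k → (M ℕ.⊔ N) ℕ.⊔ (K ℕ.⊔ L) ℕ.≤ n →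
            ℚ.∣ s k ℚ.* t k ℚ.- s n ℚ.* t n ∣ ℚ.< ε
    close k n ≤k ≤n =
      splitε {ε} (s k ℚ.* t k ℚ.- s n ℚ.* t n) (s k ℚ.* (t k ℚ.- t n)) (t n ℚ.* (s k ℚ.- s n))
        (*-sub-* (s k) (t k) (s n) (t n))
        (bound {B} (s k) (t k ℚ.- t n) (s≤B k (ℕₚ.m⊔n≤o⇒m≤o M N ≤k₁)) B≤B+C
          (t-close k n (ℕₚ.m⊔n≤o⇒n≤o K L ≤k₂) (ℕₚ.m⊔n≤o⇒n≤o K L ≤n₂)))
        (bound {C} (t n) (s k ℚ.- s n) (t≤C n (ℕₚ.m⊔n≤o⇒n≤o M N ≤n₁)) C≤B+C
          (s-close k n (ℕₚ.m⊔n≤o⇒m≤o K L ≤k₂) (ℕₚ.m⊔n≤o⇒m≤o K L ≤n₂)))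
      where
      ≤k₁ = ℕₚ.m⊔n≤o⇒m≤o (M ℕ.⊔ N) (K ℕ.⊔ L) ≤k
      ≤n₁ = ℕₚ.m⊔n≤o⇒m≤o (M ℕ.⊔ N) (K ℕ.⊔ L) ≤n
      ≤k₂ = ℕₚ.m⊔n≤o⇒n≤o (M ℕ.⊔ N) (K ℕ.⊔ L) ≤k
      ≤n₂ = ℕₚ.m⊔n≤o⇒n≤o (M ℕ.⊔ N) (K ℕ.⊔ L) ≤n

open CauchyLemmas

infix  4 _≈_ _<_ _≤_
infixl 6 _+_ _-_
infixl 7 _*_
infix  8 -_

record _≈_ (x y : ℝ) : Set where
  constructor mk≈
  field
    close : ∀ ε → 0ℚ ℚ.< ε → Eventually (λ n → ℚ.∣ seq x n ℚ.- seq y n ∣ ℚ.< ε)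

record _<_ (x y : ℝ) : Set where
  constructor mk<
  field
    gap       : ℚ
    gap-pos   : 0ℚ ℚ.< gap
    separated : Eventually (λ n → seq x n ℚ.+ gap ℚ.≤ seq y n)

_≤_ : ℝ → ℝ → Set
x ≤ y = ¬ (y < x)

-- Opaque so that the type checker does not normalise rational arithmetic
-- inside real expressions; the seq-lemmas give the defining sequences.
opaque

  fromℚ : ℚ → ℝ
  fromℚ q = mkℝ (const q) (const-cauchy q)

  -_ : ℝ → ℝ
  - x = mkℝ (λ n → ℚ.- seq x n) (neg-cauchy (seq x) (isCauchy x))

  _+_ _*_ : ℝ → ℝ → ℝ
  x + y = mkℝ (λ n → seq x n ℚ.+ seq y n) (+-cauchy (seq x) (seq y) (isCauchy x) (isCauchy y))
  x * y = mkℝ (λ n → seq x n ℚ.* seq y n) (*-cauchy (seq x) (seq y) (isCauchy x) (isCauchy y))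

  seq-fromℚ : ∀ q n → seq (fromℚ q) n ≡ q
  seq-fromℚ q n = refl

  seq-neg : ∀ x n → seq (- x) n ≡ ℚ.- seq x n
  seq-neg x n = refl

  seq-+ : ∀ x y n → seq (x + y) n ≡ seq x n ℚ.+ seq y n
  seq-+ x y n = refl

  seq-* : ∀ x y n → seq (x * y) n ≡ seq x n ℚ.* seq y n
  seq-* x y n = refl

0ℝ 1ℝ : ℝ
0ℝ = fromℚ 0ℚ
1ℝ = fromℚ 1ℚ

_-_ : ℝ → ℝ → ℝ
x - y = x + (- y)

≈-refl : ∀ {x} → x ≈ x
≈-refl {x} = mk≈ λ ε 0<ε → 0 , λ n _ → subst (ℚ._< ε) (sym (∣-∣-self (seq x n))) 0<ε

≈-sym : ∀ {x y} → x ≈ y → y ≈ x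
≈-sym {x} {y} (mk≈ x≈y) = mk≈ λ ε 0<ε →
  let N , close = x≈y ε 0<ε
  in N , λ n N≤n → subst (ℚ._< ε) (∣-∣-comm (seq x n) (seq y n)) (close n N≤n)

≈-trans : ∀ {x y z} → x ≈ y → y ≈ z → x ≈ z
≈-trans {x} {y} {z} (mk≈ x≈y) (mk≈ y≈z) = mk≈ λ ε 0<ε →
  let M , xy-close = x≈y (ε ℚ.* ½) (half-pos 0<ε)
      N , yz-close = y≈z (ε ℚ.* ½) (half-pos 0<ε)
  in M ℕ.⊔ N , λ n ≤n →
    splitε (seq x n ℚ.- seq z n) (seq x n ℚ.- seq y n) (seq y n ℚ.- seq z n)
      (telescope (seq x n) (seq y n) (seq z n))
      (xy-close n (ℕₚ.m⊔n≤o⇒m≤o M N ≤n)) (yz-close n (ℕₚ.m⊔n≤o⇒n≤o M N ≤n))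

ℝ-setoid : Setoid 0ℓ 0ℓ
ℝ-setoid = record
  { Carrier       = ℝ
  ; _≈_           = _≈_
  ; isEquivalence = record
    { refl  = ≈-refl
    ; sym   = ≈-sym
    ; trans = ≈-trans
    }
  }

∏ : ∀ {m} → Vector ℝ m → ℝ
∏ = foldr _*_ 1ℝ

∏[j≢_] : ∀ {m} → Fin m → Vector ℝ m → ℝ
∏[j≢ i ] f = ∏ (λ j → if does (j Finₚ.≟ i) then 1ℝ else f j)

------------------------------------------------------------------------
-- Cardinality of subsets of ℝᵐ

subsetSetoid : ∀ {m} → Pred (Vector ℝ m) 0ℓ → Setoid 0ℓ 0ℓ
subsetSetoid {m} P = On.setoid (Pointwise.setoid ℝ-setoid m) (proj₁ {B = P})

HasCardinality : ∀ {m} → Pred (Vector ℝ m) 0ℓ → ℕ → Set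
HasCardinality P n = Bijection (setoid (Fin n)) (subsetSetoid P)

------------------------------------------------------------------------
-- Two-action games.  Players are Fin m; the pure strategy combination
-- (s¹_{j₁}, …, sᵐ_{jₘ}) is the vector (j₁, …, jₘ).

PureProfile : ℕ → Set
PureProfile m = Vec (Fin 2) m

record TwoActionGame (m : ℕ) : Set where
  field
    U : Fin m → PureProfile m → ℝ

∑Profiles : ∀ {m} → (PureProfile m → ℝ) → ℝ
∑Profiles {zero}  f = f []
∑Profiles {suc m} f = ∑Profiles (f ∘ (zero ∷_)) + ∑Profiles (f ∘ (suc zero ∷_))

-- The probability of s_j when s_1 is played with probability x.
prob : ℝ → Fin 2 → ℝ
prob x zero       = 1ℝ - x
prob x (suc zero) = x

IsMixed : ∀ {m} → Pred (Vector ℝ m) 0ℓ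
IsMixed γ = ∀ i → 0ℝ ≤ γ i × γ i ≤ 1ℝ

module _ {m : ℕ} (G : TwoActionGame m) where
  open TwoActionGame G

  V : Fin m → Vector ℝ m → ℝ
  V i γ = ∑Profiles (λ s → ∏ (λ k → prob (γ k) (lookup s k)) * U i s)

  -- λⁱ(γ⁻ⁱ), as a function of all of γ that ignores the entry γⁱ.
  Λ : Fin m → Vector ℝ m → ℝ
  Λ i γ = V i (updateAt γ i (const 1ℝ)) - V i (updateAt γ i (const 0ℝ))

  IsNash : Pred (Vector ℝ m) 0ℓ
  IsNash γ = IsMixed γ ×
    (∀ i → (0ℝ < γ i × γ i < 1ℝ → Λ i γ ≈ 0ℝ)
         × (γ i ≈ 0ℝ → Λ i γ ≤ 0ℝ)
         × (γ i ≈ 1ℝ → 0ℝ ≤ Λ i γ))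

------------------------------------------------------------------------
-- Product two-action games

[-1]^_ : Fin 2 → ℝ
[-1]^ zero     = 1ℝ
[-1]^ suc zero = - 1ℝ

-- a i j is aⁱ_j; the entries a i i carry no condition and are never used.
record ProductGame (m : ℕ) : Set where
  field
    game       : TwoActionGame m
    v          : Fin m → Fin 2
    a          : Fin m → Fin m → ℝ
    a∈⟨0,1⟩    : ∀ i j → i ≢ j → 0ℝ < a i j × a i j < 1ℝ
    a-distinct : ∀ i₁ i₂ j → i₁ ≢ i₂ → i₁ ≢ j → i₂ ≢ j → ¬ (a i₁ j ≈ a i₂ j)
    Λ-product  : ∀ i γ → IsMixed γ →
                 Λ game i γ ≈ ([-1]^ v i) * ∏[j≢ i ] (λ j → γ j - a i j)

module _ {m : ℕ} (P : ProductGame m) where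
  open ProductGame P

  IsAssociatedPermutation : Fin m → Permutation′ m → Set
  IsAssociatedPermutation j σ =
    σ ⟨$⟩ʳ j ≡ j ×
    (∀ i i′ → i ≢ j → i′ ≢ j → σ ⟨$⟩ʳ i Fin.< σ ⟨$⟩ʳ i′ ⇔ a i′ j < a i j)

  IsCharacteristicTuple : (Fin m → Fin 2) → (Fin m → Permutation′ m) → Set
  IsCharacteristicTuple w σ =
    (∀ i → v i ≡ w i) × (∀ j → IsAssociatedPermutation j (σ j))

module _ {m : ℕ} where

  _∈L_ : Fin m → Vector ℝ m → Set
  i ∈L γ = γ i ≈ 0ℝ ⊎ γ i ≈ 1ℝ

  _∈F_ : Fin m → Permutation′ m → Set
  i ∈F π = π ⟨$⟩ʳ i ≡ i

  IsDerangement : Permutation′ m → Set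
  IsDerangement π = ∀ i → ¬ (i ∈F π)

module _ {m : ℕ} (P : ProductGame m) where
  open ProductGame P

  EC : Permutation′ m → Pred (Vector ℝ m) 0ℓ
  EC π γ = IsMixed γ
         × (∀ i → i ∈L γ ⇔ i ∈F π)
         × (∀ j → ¬ (j ∈F π) → γ j ≈ a (π ⟨$⟩ʳ j) j)

  IsMaximal : Set
  IsMaximal = ∀ π → ¬ IsDerangement π →
    ∃[ n ] (HasCardinality (EC π) (2 ℕ.* n) × HasCardinality (EC π ∩ IsNash game) n)

IsDelta : ∀ {m} → Fin m → Permutation′ m → Set
IsDelta j δ =
  δ ⟨$⟩ʳ j ≡ j ×
  (∀ k₁ k₂ → k₁ ≢ j → k₂ ≢ j → k₁ Fin.< k₂ →
    δ ⟨$⟩ʳ k₂ Fin.< δ ⟨$⟩ʳ k₁ ⇔ (k₁ Fin.< j × j Fin.< k₂))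

{-# OPTIONS --safe #-}

-- A point of EC(π) is a choice of γᵏ ∈ {0,1} at the fixed points k of π; encode 0 as the sign −
-- and 1 as +.  For a fixed point i, no factor of Λⁱ vanishes.  The factor of a fixed point k has
-- the chosen sign tₖ.  The factor of a moved point k is a (π k) k − a i k, which for δᵏ
-- is negative exactly when i lies on the arc that runs cyclically upwards from k to π(k).
-- The number of arcs k → π(k) passing over a point on the circle does not depend on the point,
-- since every point starts as many arcs as it ends.  Hence the sign of Λⁱ is tᵢ · (∏ t · W) with W
-- independent of i, and γ is a Nash equilibrium iff ∏ t · W = +, which holds for half of the t.
-- At a moved point i, Λⁱ = 0 because of the factor k = π⁻¹(i).

module Submission where

open import Defs
open Defs.CauchyLemmas
import Algebra.Properties.CommutativeMonoid.Sum as Sum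
open import Data.Bool.Base using (if_then_else_)
open import Data.Fin.Base as Fin using (Fin; zero; suc; toℕ; punchIn; punchOut)
open import Data.Fin.Permutation using (Permutation; Permutation′; _⟨$⟩ʳ_; _⟨$⟩ˡ_; inverseˡ; inverseʳ; insert; insert-punchIn; cast-id; _∘ₚ_)
open import Data.Fin.Properties as Finₚ using ()
import Data.Integer.Base as ℤ
open import Data.Nat.Base as ℕ using (ℕ; zero; suc)
open import Data.Nat.Properties as ℕₚ using ()
open import Data.Product.Base using (_×_; _,_; ∃-syntax; proj₁; proj₂)
open import Data.Rational as ℚ using (ℚ; 0ℚ; 1ℚ; ½)
open import Data.Rational.Properties as ℚₚ using ()
open import Data.Rational.Solver using (module +-*-Solver)
open import Data.Sign.Base as Sign using (Sign)
open import Data.Sign.Properties as Signₚ using ()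
open import Data.Sum.Algebra using (⊎-comm)
open import Data.Sum.Base using (_⊎_; inj₁; inj₂)
open import Data.Vec.Base using ([]; _∷_; lookup)
open import Data.Vec.Functional as Vector using (Vector; updateAt)
open import Data.Vec.Functional.Properties using (updateAt-updates; updateAt-minimal)
open import Function.Base using (_∘_; const)
open import Function.Bundles using (Equivalence; _⇔_; mk⇔)
open import Function.Construct.Composition using (_↔-∘_)
open import Function.Construct.Symmetry using (↔-sym)
open import Level using (0ℓ)
open import Relation.Binary.Definitions using (tri<; tri≈; tri>)
open import Relation.Binary.PropositionalEquality using (_≡_; _≢_; refl; sym; trans; cong; cong₂; subst; subst₂; module ≡-Reasoning)
open import Relation.Nullary.Decidable using (Dec; does; yes; no; dec-true; dec-false; _×-dec_; ¬?)
open import Relation.Nullary.Negation using (¬_; contradiction)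
open import Relation.Unary using (Pred; Decidable; _∩_)

open Equivalence using (to; from)
open Sum Signₚ.*-commutativeMonoid using () renaming (sum to ∏ˢ; sum-cong-≗ to ∏ˢ-cong; sum-permute to ∏ˢ-permute; ∑-distrib-+ to ∏ˢ-distrib-*; sum-replicate-zero to ∏ˢ-replicate-+)
open Sum ℚₚ.*-1-commutativeMonoid using () renaming (sum to ∏ℚ; sum-cong-≗ to ∏ℚ-cong; ∑-distrib-+ to ∏ℚ-distrib-*)

-- Real arithmetic

p≤∣p∣ : ∀ p → p ℚ.≤ ℚ.∣ p ∣
p≤∣p∣ p with ℚₚ.≤-total 0ℚ p
... | inj₁ 0≤p = ℚₚ.≤-reflexive (sym (ℚₚ.0≤p⇒∣p∣≡p 0≤p))
... | inj₂ p≤0 = ℚₚ.≤-trans p≤0 (ℚₚ.0≤∣p∣ p)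

∣p-q∣<h⇒p-h≤q : ∀ {h} p q → ℚ.∣ p ℚ.- q ∣ ℚ.< h → p ℚ.- h ℚ.≤ q
∣p-q∣<h⇒p-h≤q {h} p q p-q<h = subst₂ ℚ._≤_
  (solve 3 (λ p q h → (p :- q) :+ (q :- h) := p :- h) refl p q h)
  (solve 2 (λ q h → h :+ (q :- h) := q) refl q h)
  (ℚₚ.+-monoˡ-≤ (q ℚ.- h) (ℚₚ.≤-trans (p≤∣p∣ (p ℚ.- q)) (ℚₚ.<⇒≤ p-q<h)))
  where open +-*-Solver

p+q≤r⇒q≤r-p : ∀ p q r → p ℚ.+ q ℚ.≤ r → q ℚ.≤ r ℚ.- p
p+q≤r⇒q≤r-p p q r p+q≤r = subst (ℚ._≤ r ℚ.- p)
  (solve 2 (λ p q → (p :+ q) :- p := q) refl p q)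
  (ℚₚ.+-monoˡ-≤ (ℚ.- p) p+q≤r)
  where open +-*-Solver

Eventually-∩ : ∀ {P Q R : ℕ → Set} → (∀ n → P n → Q n → R n) →
               Eventually P → Eventually Q → Eventually R
Eventually-∩ f (M , p) (N , q) = M ℕ.⊔ N , λ n ≤n →
  f n (p n (ℕₚ.m⊔n≤o⇒m≤o M N ≤n)) (q n (ℕₚ.m⊔n≤o⇒n≤o M N ≤n))

seq-≈ : ∀ {x y} → (∀ n → seq x n ≡ seq y n) → x ≈ y
seq-≈ {x} {y} x≗y = mk≈ λ ε 0<ε → 0 , λ n _ →
  subst (ℚ._< ε) (sym (trans (cong (λ p → ℚ.∣ p ℚ.- seq y n ∣) (x≗y n)) (∣-∣-self (seq y n)))) 0<ε

seq-- : ∀ x y n → seq (x - y) n ≡ seq x n ℚ.- seq y n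
seq-- x y n = trans (seq-+ x (- y) n) (cong (seq x n ℚ.+_) (seq-neg y n))

-- Half of the gap is kept: `z` eventually stays within the other half of `y`.
<-respʳ-≈ : ∀ {x y z} → y ≈ z → x < y → x < z
<-respʳ-≈ {x} {y} {z} (mk≈ y≈z) (mk< g 0<g x<y) = mk< (g ℚ.* ½) (half-pos 0<g)
  (Eventually-∩ (λ n x+g≤y close → subst (ℚ._≤ seq z n) (eq (seq x n))
      (ℚₚ.≤-trans (ℚₚ.+-monoˡ-≤ (ℚ.- (g ℚ.* ½)) x+g≤y) (∣p-q∣<h⇒p-h≤q (seq y n) (seq z n) close)))
    x<y (y≈z (g ℚ.* ½) (half-pos 0<g)))
  where
  open +-*-Solver
  eq : ∀ p → (p ℚ.+ g) ℚ.- g ℚ.* ½ ≡ p ℚ.+ g ℚ.* ½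
  eq p = trans (cong (λ q → (p ℚ.+ q) ℚ.- g ℚ.* ½) (sym (halves g)))
    (solve 2 (λ p h → (p :+ (h :+ h)) :- h := p :+ h) refl p (g ℚ.* ½))

<-irrefl : ∀ {x} → ¬ x < x
<-irrefl {x} (mk< g 0<g (N , x<x)) = ℚₚ.<-irrefl refl
  (ℚₚ.<-≤-trans (subst (ℚ._< seq x N ℚ.+ g) (ℚₚ.+-identityʳ (seq x N)) (ℚₚ.+-monoʳ-< (seq x N) 0<g))
    (x<x N ℕₚ.≤-refl))

<-trans : ∀ {x y z} → x < y → y < z → x < z
<-trans {x} {y} {z} (mk< g 0<g x<y) (mk< h 0<h y<z) = mk< g 0<g
  (Eventually-∩ (λ n x+g≤y y+h≤z → ℚₚ.≤-trans x+g≤y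
    (ℚₚ.≤-trans (subst (ℚ._≤ seq y n ℚ.+ h) (ℚₚ.+-identityʳ (seq y n)) (ℚₚ.+-monoʳ-≤ (seq y n) (ℚₚ.<⇒≤ 0<h))) y+h≤z))
    x<y y<z)

<⇒≤ : ∀ {x y} → x < y → x ≤ y
<⇒≤ x<y y<x = <-irrefl (<-trans x<y y<x)

<⇒≉ : ∀ {x y} → x < y → ¬ x ≈ y
<⇒≉ x<y x≈y = <-irrefl (<-respʳ-≈ (≈-sym x≈y) x<y)

neg-cong : ∀ {x y} → x ≈ y → - x ≈ - y
neg-cong {x} {y} (mk≈ x≈y) = mk≈ λ ε 0<ε → let N , close = x≈y ε 0<ε in N , λ n N≤n →
  subst (ℚ._< ε) (sym (eq n)) (close n N≤n)
  where
  eq : ∀ n → ℚ.∣ seq (- x) n ℚ.- seq (- y) n ∣ ≡ ℚ.∣ seq x n ℚ.- seq y n ∣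
  eq n = trans (cong₂ (λ p q → ℚ.∣ p ℚ.- q ∣) (seq-neg x n) (seq-neg y n))
    (trans (cong ℚ.∣_∣ (sym (ℚₚ.neg-distrib-+ (seq x n) (ℚ.- seq y n)))) (ℚₚ.∣-p∣≡∣p∣ (seq x n ℚ.- seq y n)))

-‿congˡ : ∀ {x y z} → x ≈ y → x - z ≈ y - z
-‿congˡ {x} {y} {z} (mk≈ x≈y) = mk≈ λ ε 0<ε → let N , close = x≈y ε 0<ε in N , λ n N≤n →
  subst (ℚ._< ε) (cong ℚ.∣_∣ (sym (eq n))) (close n N≤n)
  where
  open +-*-Solver
  eq : ∀ n → seq (x - z) n ℚ.- seq (y - z) n ≡ seq x n ℚ.- seq y n
  eq n = trans (cong₂ ℚ._-_ (seq-- x z n) (seq-- y z n))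
    (solve 3 (λ x y z → (x :- z) :- (y :- z) := x :- y) refl (seq x n) (seq y n) (seq z n))

x≈y⇒x-y≈0 : ∀ {x y} → x ≈ y → x - y ≈ 0ℝ
x≈y⇒x-y≈0 {x} {y} x≈y = ≈-trans (-‿congˡ x≈y) (seq-≈ λ n →
  trans (seq-- y y n) (trans (ℚₚ.+-inverseʳ (seq y n)) (sym (seq-fromℚ 0ℚ n))))

x<y⇒0<y-x : ∀ {x y} → x < y → 0ℝ < y - x
x<y⇒0<y-x {x} {y} (mk< g 0<g (N , x<y)) = mk< g 0<g (N , λ n N≤n →
  subst₂ ℚ._≤_
    (trans (sym (ℚₚ.+-identityˡ g)) (cong (ℚ._+ g) (sym (seq-fromℚ 0ℚ n))))
    (sym (seq-- y x n))
    (p+q≤r⇒q≤r-p (seq x n) g (seq y n) (x<y n N≤n)))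

fromℚ-mono-< : ∀ {p q} → p ℚ.< q → fromℚ p < fromℚ q
fromℚ-mono-< {p} {q} p<q = mk< (q ℚ.- p)
  (subst (ℚ._< q ℚ.- p) (ℚₚ.+-inverseʳ p) (ℚₚ.+-monoˡ-< (ℚ.- p) p<q))
  (0 , λ n _ → ℚₚ.≤-reflexive (trans (cong (ℚ._+ (q ℚ.- p)) (seq-fromℚ p n))
    (trans (solve 2 (λ p q → p :+ (q :- p) := q) refl p q) (sym (seq-fromℚ q n)))))
  where open +-*-Solver

0<1 : 0ℝ < 1ℝ
0<1 = fromℚ-mono-< (ℚₚ.positive⁻¹ 1ℚ)

*-pos-ℝ : ∀ {x y} → 0ℝ < x → 0ℝ < y → 0ℝ < x * y
*-pos-ℝ {x} {y} (mk< g 0<g 0<x) (mk< h 0<h 0<y) = mk< (g ℚ.* h) (*-pos 0<g 0<h)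
  (Eventually-∩ (λ n g≤x h≤y →
    subst₂ ℚ._≤_
      (trans (sym (ℚₚ.+-identityˡ (g ℚ.* h))) (cong (ℚ._+ g ℚ.* h) (sym (seq-fromℚ 0ℚ n))))
      (sym (seq-* x y n))
      (mul≤ n (drop0 g n g≤x) (drop0 h n h≤y)))
    0<x 0<y)
  where
  drop0 : ∀ g n {p} → seq 0ℝ n ℚ.+ g ℚ.≤ p → g ℚ.≤ p
  drop0 g n = subst (ℚ._≤ _) (trans (cong (ℚ._+ g) (seq-fromℚ 0ℚ n)) (ℚₚ.+-identityˡ g))
  mul≤ : ∀ n → g ℚ.≤ seq x n → h ℚ.≤ seq y n → g ℚ.* h ℚ.≤ seq x n ℚ.* seq y n
  mul≤ n g≤x h≤y = ℚₚ.≤-trans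
    (ℚₚ.*-monoˡ-≤-nonNeg g {{ℚ.nonNegative (ℚₚ.<⇒≤ 0<g)}} h≤y)
    (ℚₚ.*-monoʳ-≤-nonNeg (seq y n) {{ℚ.nonNegative (ℚₚ.≤-trans (ℚₚ.<⇒≤ 0<h) h≤y)}} g≤x)

-- A Cauchy sequence is eventually bounded by some `B`, so the tolerance `η` with `B * η ≡ ε` for
-- `y` suffices for the product.
*-zeroʳ-≈ : ∀ x {y} → y ≈ 0ℝ → x * y ≈ 0ℝ
*-zeroʳ-≈ x {y} (mk≈ y≈0) = mk≈ λ ε 0<ε →
  let B , 0<B , x≤B = bounded (seq x) (isCauchy x)
      η , 0<η , Bη≡ε = scale {B} {ε} 0<B 0<ε
  in Eventually-∩ (λ n xn≤B yn<η → subst₂ ℚ._<_ (cong ℚ.∣_∣ (sym (eq n))) Bη≡ε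
       (∣*∣-bound (seq x n) (seq y n ℚ.- seq 0ℝ n) 0<B xn≤B ℚₚ.≤-refl yn<η))
     x≤B (y≈0 η 0<η)
  where
  eq : ∀ n → seq (x * y) n ℚ.- seq 0ℝ n ≡ seq x n ℚ.* (seq y n ℚ.- seq 0ℝ n)
  eq n rewrite seq-* x y n | seq-fromℚ 0ℚ n | ℚₚ.+-identityʳ (seq x n ℚ.* seq y n) | ℚₚ.+-identityʳ (seq y n) = refl

*-zeroˡ-≈ : ∀ {x} y → x ≈ 0ℝ → x * y ≈ 0ℝ
*-zeroˡ-≈ {x} y x≈0 = ≈-trans (seq-≈ λ n →
    trans (seq-* x y n) (trans (ℚₚ.*-comm (seq x n) (seq y n)) (sym (seq-* y x n))))
  (*-zeroʳ-≈ y x≈0)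

*-identityˡ : ∀ x → 1ℝ * x ≈ x
*-identityˡ x = seq-≈ λ n → trans (seq-* 1ℝ x n)
  (trans (cong (ℚ._* seq x n) (seq-fromℚ 1ℚ n)) (ℚₚ.*-identityˡ (seq x n)))

∏-zero : ∀ {m} (f : Vector ℝ m) i → f i ≈ 0ℝ → ∏ f ≈ 0ℝ
∏-zero f zero    f0≈0 = *-zeroˡ-≈ (∏ (f ∘ suc)) f0≈0
∏-zero f (suc i) fi≈0 = *-zeroʳ-≈ (f zero) (∏-zero (f ∘ suc) i fi≈0)

-- Signs of real numbers

infixr 8 _◂_

_◂_ : Sign → ℝ → ℝ
Sign.+ ◂ x = x
Sign.- ◂ x = - x

-- The sign of a Cauchy real cannot be read off its sequence by a decision, so it is carried as
-- evidence of a strict inequality.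
HasSign : Sign → ℝ → Set
HasSign s x = 0ℝ < s ◂ x

HasSign-resp-≈ : ∀ s {x y} → x ≈ y → HasSign s x → HasSign s y
HasSign-resp-≈ Sign.+ x≈y = <-respʳ-≈ x≈y
HasSign-resp-≈ Sign.- x≈y = <-respʳ-≈ (neg-cong x≈y)

◂-*-◂ : ∀ s t x y → (s ◂ x) * (t ◂ y) ≈ (s Sign.* t) ◂ (x * y)
◂-*-◂ Sign.+ Sign.+ x y = ≈-refl
◂-*-◂ Sign.+ Sign.- x y = seq-≈ λ n →
  trans (seq-* x (- y) n) (trans (cong (seq x n ℚ.*_) (seq-neg y n))
    (trans (sym (ℚₚ.neg-distribʳ-* (seq x n) (seq y n)))
      (trans (cong ℚ.-_ (sym (seq-* x y n))) (sym (seq-neg (x * y) n)))))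
◂-*-◂ Sign.- Sign.+ x y = seq-≈ λ n →
  trans (seq-* (- x) y n) (trans (cong (ℚ._* seq y n) (seq-neg x n))
    (trans (sym (ℚₚ.neg-distribˡ-* (seq x n) (seq y n)))
      (trans (cong ℚ.-_ (sym (seq-* x y n))) (sym (seq-neg (x * y) n)))))
◂-*-◂ Sign.- Sign.- x y = seq-≈ λ n →
  trans (seq-* (- x) (- y) n) (trans (cong₂ ℚ._*_ (seq-neg x n) (seq-neg y n))
    (trans (solve 2 (λ x y → (:- x) :* (:- y) := x :* y) refl (seq x n) (seq y n)) (sym (seq-* x y n))))
  where open +-*-Solver

HasSign-* : ∀ s t {x y} → HasSign s x → HasSign t y → HasSign (s Sign.* t) (x * y)
HasSign-* s t {x} {y} sx ty = <-respʳ-≈ (◂-*-◂ s t x y) (*-pos-ℝ sx ty)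

HasSign-∏ : ∀ {m} {s : Vector Sign m} {f : Vector ℝ m} →
            (∀ k → HasSign (s k) (f k)) → HasSign (∏ˢ s) (∏ f)
HasSign-∏ {zero}          sf = 0<1
HasSign-∏ {suc m} {s} {f} sf = HasSign-* (s zero) (∏ˢ (s ∘ suc)) (sf zero) (HasSign-∏ (sf ∘ suc))

HasSign-sub-- : ∀ {x y} → x < y → HasSign Sign.- (x - y)
HasSign-sub-- {x} {y} x<y = <-respʳ-≈ (seq-≈ λ n →
    trans (seq-- y x n) (trans (sym (neg-sub (seq x n) (seq y n)))
      (trans (cong ℚ.-_ (sym (seq-- x y n))) (sym (seq-neg (x - y) n)))))
  (x<y⇒0<y-x x<y)

0<-x⇒x<0 : ∀ {x} → 0ℝ < - x → x < 0ℝ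
0<-x⇒x<0 {x} (mk< g 0<g (N , g≤-x)) = mk< g 0<g (N , λ n N≤n →
  subst₂ ℚ._≤_ (eq n) (trans (ℚₚ.+-inverseˡ (seq x n)) (sym (seq-fromℚ 0ℚ n)))
    (ℚₚ.+-monoˡ-≤ (seq x n) (subst (_ ℚ.≤_) (seq-neg x n) (g≤-x n N≤n))))
  where
  eq : ∀ n → (seq 0ℝ n ℚ.+ g) ℚ.+ seq x n ≡ seq x n ℚ.+ g
  eq n = trans (cong (λ z → (z ℚ.+ g) ℚ.+ seq x n) (seq-fromℚ 0ℚ n))
    (trans (cong (ℚ._+ seq x n) (ℚₚ.+-identityˡ g)) (ℚₚ.+-comm g (seq x n)))

0<-x⇒x≤0 : ∀ {x} → 0ℝ < - x → x ≤ 0ℝ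
0<-x⇒x≤0 = <⇒≤ ∘ 0<-x⇒x<0

-- Signs and arcs

-- As a factor under `∏ˢ`, this inserts or cancels a sign at one player while the product still runs
-- over all players.
at : ∀ {m} → Fin m → Sign → Vector Sign m
at i s k = if does (k Finₚ.≟ i) then s else Sign.+

at-≡ : ∀ {m} (i : Fin m) s → at i s i ≡ s
at-≡ i s rewrite dec-true (i Finₚ.≟ i) refl = refl

at-≢ : ∀ {m} {i k : Fin m} s → k ≢ i → at i s k ≡ Sign.+
at-≢ {i = i} {k} s k≢i rewrite dec-false (k Finₚ.≟ i) k≢i = refl

∏ˢ-at : ∀ {m} (i : Fin m) s → ∏ˢ (at i s) ≡ s
∏ˢ-at {suc m} zero    s = trans (cong (s Sign.*_) (∏ˢ-replicate-+ m)) (Signₚ.*-identityʳ s)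
∏ˢ-at {suc m} (suc i) s = trans (∏ˢ-cong {m} {λ k → at (suc i) s (suc k)} {at i s} at-suc) (∏ˢ-at i s)
  where
  at-suc : ∀ k → at (suc i) s (suc k) ≡ at i s k
  at-suc k with k Finₚ.≟ i
  ... | yes _ = refl
  ... | no  _ = refl

-- Encoding truth as - makes a product of such signs the parity of the number of true inequalities.
lt : ∀ {m} → Fin m → Fin m → Sign
lt x y = if does (x Finₚ.<? y) then Sign.- else Sign.+

lt-< : ∀ {m} {x y : Fin m} → x Fin.< y → lt x y ≡ Sign.-
lt-< {x = x} {y} x<y rewrite dec-true (x Finₚ.<? y) x<y = refl

lt-≮ : ∀ {m} {x y : Fin m} → ¬ x Fin.< y → lt x y ≡ Sign.+
lt-≮ {x = x} {y} x≮y rewrite dec-false (x Finₚ.<? y) x≮y = refl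

-- − iff the arc running cyclically upwards from k to p passes over i (for distinct i, k, p).
crossing : ∀ {m} → Fin m → Fin m → Fin m → Sign
crossing i k p = (lt k i Sign.* lt p i) Sign.* lt p k

-- Makes the terms of fixed points neutral, so that products of crossings may range over all
-- players.
crossing-loop : ∀ {m} (i k : Fin m) → crossing i k k ≡ Sign.+
crossing-loop i k = cong₂ Sign._*_ (Signₚ.s*s≡+ (lt k i)) (lt-≮ (Finₚ.<-irrefl {x = k} refl))

-- As many arcs start below i as end below i; only the descents of π remain.
∏ˢ-crossing : ∀ {m} (π : Permutation′ m) i →
              ∏ˢ (λ k → crossing i k (π ⟨$⟩ʳ k)) ≡ ∏ˢ (λ k → lt (π ⟨$⟩ʳ k) k)
∏ˢ-crossing π i = begin
  ∏ˢ (λ k → crossing i k (π ⟨$⟩ʳ k))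
    ≡⟨ ∏ˢ-distrib-* (λ k → A k Sign.* A (π ⟨$⟩ʳ k)) W ⟩
  ∏ˢ (λ k → A k Sign.* A (π ⟨$⟩ʳ k)) Sign.* ∏ˢ W
    ≡⟨ cong (Sign._* ∏ˢ W) (∏ˢ-distrib-* A (λ k → A (π ⟨$⟩ʳ k))) ⟩
  (∏ˢ A Sign.* ∏ˢ (λ k → A (π ⟨$⟩ʳ k))) Sign.* ∏ˢ W
    ≡⟨ cong (λ s → (∏ˢ A Sign.* s) Sign.* ∏ˢ W) (sym (∏ˢ-permute A π)) ⟩
  (∏ˢ A Sign.* ∏ˢ A) Sign.* ∏ˢ W
    ≡⟨ cong (Sign._* ∏ˢ W) (Signₚ.s*s≡+ (∏ˢ A)) ⟩
  ∏ˢ W ∎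
  where
  open ≡-Reasoning
  A W : Vector Sign _
  A k = lt k i
  W k = lt (π ⟨$⟩ʳ k) k

permutation-injective : ∀ {m} (π : Permutation′ m) {i j} → π ⟨$⟩ʳ i ≡ π ⟨$⟩ʳ j → i ≡ j
permutation-injective π eq = trans (sym (inverseˡ π)) (trans (cong (π ⟨$⟩ˡ_) eq) (inverseˡ π))

crossing-≡ : ∀ {m} (i k p : Fin m) {s t u} → lt k i ≡ s → lt p i ≡ t → lt p k ≡ u →
             crossing i k p ≡ (s Sign.* t) Sign.* u
crossing-≡ _ _ _ refl refl refl = refl

-- `IsDelta` characterises only the descents; since `δ` is injective, trichotomy leaves an ascent.
delta-ascends : ∀ {m} {j : Fin m} {δ} → IsDelta j δ → ∀ {k₁ k₂} → k₁ ≢ j → k₂ ≢ j → k₁ Fin.< k₂ →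
                ¬ (k₁ Fin.< j × j Fin.< k₂) → δ ⟨$⟩ʳ k₁ Fin.< δ ⟨$⟩ʳ k₂
delta-ascends {δ = δ} (_ , desc) {k₁} {k₂} k₁≢j k₂≢j k₁<k₂ ¬sep
  with Finₚ.<-cmp (δ ⟨$⟩ʳ k₁) (δ ⟨$⟩ʳ k₂)
... | tri< δ₁<δ₂ _ _ = δ₁<δ₂
... | tri≈ _ δ₁≡δ₂ _ = contradiction k₁<k₂ (Finₚ.<-irrefl (permutation-injective δ δ₁≡δ₂))
... | tri> _ _ δ₂<δ₁ = contradiction (to (desc k₁ k₂ k₁≢j k₂≢j k₁<k₂) δ₂<δ₁) ¬sep

-- Couples the order of the `δ`-images, which decides the sign of a difference of thresholds, with
-- the matching value of `crossing`.
data CrossingView {m} (δ : Permutation′ m) (i k p : Fin m) : Set where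
  crosses : δ ⟨$⟩ʳ i Fin.< δ ⟨$⟩ʳ p → crossing i k p ≡ Sign.- → CrossingView δ i k p
  avoids  : δ ⟨$⟩ʳ p Fin.< δ ⟨$⟩ʳ i → crossing i k p ≡ Sign.+ → CrossingView δ i k p

-- `δ` lists the players above `k` in increasing order and then those below `k`: the cyclic order
-- read from `k` onwards. Hence `i` precedes `p` exactly when the arc from `k` to `p` passes over
-- `i`.
crossingView : ∀ {m} {k : Fin m} {δ} → IsDelta k δ → ∀ {i p} → i ≢ k → p ≢ k → i ≢ p →
               CrossingView δ i k p
crossingView {k = k} {δ} isDelta@(_ , desc) {i} {p} i≢k p≢k i≢p
  with Finₚ.<-cmp i p | Finₚ.<-cmp k i | Finₚ.<-cmp p k
... | tri≈ _ i≡p _ | _ | _ = contradiction i≡p i≢p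
... | _ | tri≈ _ k≡i _ | _ = contradiction (sym k≡i) i≢k
... | _ | _ | tri≈ _ p≡k _ = contradiction p≡k p≢k
-- Without ties, eight patterns remain: two cyclic ones, which are impossible, and the six linear
-- orders of three points.
... | tri< i<p _ p≮i | tri< k<i _ _ | tri< p<k _ _ = contradiction (Finₚ.<-trans k<i i<p) (ℕₚ.<⇒≯ p<k)
... | tri> _ _ p<i | tri> k≮i _ i<k | tri> p≮k _ k<p = contradiction (Finₚ.<-trans i<k k<p) (ℕₚ.<⇒≯ p<i)
... | tri< i<p _ p≮i | tri< k<i _ i≮k | tri> p≮k _ k<p =
  crosses (delta-ascends {δ = δ} isDelta i≢k p≢k i<p (i≮k ∘ proj₁)) (crossing-≡ i k p (lt-< k<i) (lt-≮ p≮i) (lt-≮ p≮k))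
... | tri< i<p _ p≮i | tri> k≮i _ i<k | tri< p<k _ k≮p =
  crosses (delta-ascends {δ = δ} isDelta i≢k p≢k i<p (k≮p ∘ proj₂)) (crossing-≡ i k p (lt-≮ k≮i) (lt-≮ p≮i) (lt-< p<k))
... | tri< i<p _ p≮i | tri> k≮i _ i<k | tri> p≮k _ k<p =
  avoids (from (desc i p i≢k p≢k i<p) (i<k , k<p)) (crossing-≡ i k p (lt-≮ k≮i) (lt-≮ p≮i) (lt-≮ p≮k))
... | tri> _ _ p<i | tri< k<i _ _ | tri< p<k _ _ =
  crosses (from (desc p i p≢k i≢k p<i) (p<k , k<i)) (crossing-≡ i k p (lt-< k<i) (lt-< p<i) (lt-< p<k))
... | tri> _ _ p<i | tri< k<i _ _ | tri> p≮k _ k<p =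
  avoids (delta-ascends {δ = δ} isDelta p≢k i≢k p<i (p≮k ∘ proj₁)) (crossing-≡ i k p (lt-< k<i) (lt-< p<i) (lt-≮ p≮k))
... | tri> _ _ p<i | tri> k≮i _ i<k | tri< p<k _ _ =
  avoids (delta-ascends {δ = δ} isDelta p≢k i≢k p<i (k≮i ∘ proj₂)) (crossing-≡ i k p (lt-≮ k≮i) (lt-< p<i) (lt-< p<k))

-- Enumeration of sign vectors

signOf : Fin 2 → Sign
signOf zero       = Sign.-
signOf (suc zero) = Sign.+

signOf-injective : ∀ {x y} → signOf x ≡ signOf y → x ≡ y
signOf-injective {zero}     {zero}     _ = refl
signOf-injective {suc zero} {suc zero} _ = refl
signOf-injective {zero}     {suc zero} ()
signOf-injective {suc zero} {zero}     ()

signOf-surjective : ∀ s → ∃[ x ] signOf x ≡ s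
signOf-surjective Sign.- = zero , refl
signOf-surjective Sign.+ = suc zero , refl

-- The factor 2 is read as the choice of one further sign.
unpair : ∀ n → Fin (2 ℕ.* n) → Sign × Fin n
unpair n x = let q , r = Fin.remQuot {2} n x in signOf q , r

unpair-injective : ∀ n {x y} → proj₁ (unpair n x) ≡ proj₁ (unpair n y) →
                   proj₂ (unpair n x) ≡ proj₂ (unpair n y) → x ≡ y
unpair-injective n {x} {y} eq₁ eq₂ = trans (sym (Finₚ.combine-remQuot {2} n x))
  (trans (cong₂ Fin.combine (signOf-injective eq₁) eq₂) (Finₚ.combine-remQuot {2} n y))

unpair-surjective : ∀ n s (r : Fin n) → ∃[ x ] unpair n x ≡ (s , r)
unpair-surjective n s r = let q , q≡s = signOf-surjective s in Fin.combine q r ,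
  trans (cong (λ z → signOf (proj₁ z) , proj₂ z) (Finₚ.remQuot-combine q r)) (cong (_, r) q≡s)

-- An enumeration of all sign patterns on `D` without repetition. Padding with + off `D` lets
-- products over all indices stand for products over `D`.
record SignVectors {m} (D : Pred (Fin m) 0ℓ) : Set where
  field
    count      : ℕ
    vector     : Fin count → Vector Sign m
    off        : ∀ x {k} → ¬ D k → vector x k ≡ Sign.+
    injective  : ∀ {x y} → (∀ k → D k → vector x k ≡ vector y k) → x ≡ y
    surjective : ∀ (b : Vector Sign m) → ∃[ x ] ∀ k → D k → vector x k ≡ b k

signVectors : ∀ {m} {D : Pred (Fin m) 0ℓ} → Decidable D → SignVectors D
signVectors {zero} D? = record
  { count      = 1
  ; vector     = λ _ ()
  ; off        = λ _ {k} → contradiction k λ ()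
  ; injective  = λ { {zero} {zero} _ → refl }
  ; surjective = λ _ → zero , λ ()
  }
signVectors {suc m} {D} D? with signVectors (D? ∘ suc) | D? zero
... | E | yes d = record
  { count      = 2 ℕ.* count
  ; vector     = λ x → proj₁ (unpair count x) Vector.∷ vector (proj₂ (unpair count x))
  ; off        = λ { x {zero} ¬d → contradiction d ¬d ; x {suc k} ¬d → off (proj₂ (unpair count x)) ¬d }
  ; injective  = λ eq → unpair-injective count (eq zero d) (injective (λ k → eq (suc k)))
  ; surjective = λ b → let r , r-eq = surjective (b ∘ suc)
                           x , x-eq = unpair-surjective count (b zero) r
                       in x , λ { zero _ → cong proj₁ x-eq
                                ; (suc k) dk → trans (cong (λ z → vector (proj₂ z) k) x-eq) (r-eq k dk) }
  }
  where open SignVectors E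
... | E | no ¬d = record
  { count      = count
  ; vector     = λ x → Sign.+ Vector.∷ vector x
  ; off        = λ { x {zero} _ → refl ; x {suc k} → off x }
  ; injective  = λ eq → injective (λ k → eq (suc k))
  ; surjective = λ b → let r , r-eq = surjective (b ∘ suc)
                       in r , λ { zero d → contradiction d ¬d ; (suc k) → r-eq k }
  }
  where open SignVectors E

-- `subsetSetoid` compares points coordinatewise and ignores membership proofs, so a listing of
-- points without repetition or omission gives the bijection.
hasCardinality : ∀ {m n} {P : Pred (Vector ℝ m) 0ℓ} (f : Fin n → Vector ℝ m) → (∀ x → P (f x)) →
                 (∀ {x y} → (∀ k → f x k ≈ f y k) → x ≡ y) →
                 (∀ γ → P γ → ∃[ x ] ∀ k → f x k ≈ γ k) →
                 HasCardinality P n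
hasCardinality f f∈P inj surj = record
  { to        = λ x → f x , f∈P x
  ; cong      = λ { refl k → ≈-refl }
  ; bijective = inj , λ { (γ , γ∈P) → let x , eq = surj γ γ∈P in x , λ { refl → eq } }
  }

≡⇒≈ : ∀ {x y} → x ≡ y → x ≈ y
≡⇒≈ refl = ≈-refl

-- Corners and best replies

corner : Sign → ℝ
corner Sign.- = 0ℝ
corner Sign.+ = 1ℝ

corner-∈L : ∀ s {x} → x ≈ corner s → x ≈ 0ℝ ⊎ x ≈ 1ℝ
corner-∈L Sign.- = inj₁
corner-∈L Sign.+ = inj₂

corner-∈[0,1] : ∀ s → 0ℝ ≤ corner s × corner s ≤ 1ℝ
corner-∈[0,1] Sign.- = <-irrefl , <⇒≤ 0<1
corner-∈[0,1] Sign.+ = <⇒≤ 0<1 , <-irrefl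

corner-injective : ∀ {s t} → corner s ≈ corner t → s ≡ t
corner-injective {Sign.-} {Sign.-} _   = refl
corner-injective {Sign.-} {Sign.+} 0≈1 = contradiction 0≈1 (<⇒≉ 0<1)
corner-injective {Sign.+} {Sign.-} 1≈0 = contradiction (≈-sym 1≈0) (<⇒≉ 0<1)
corner-injective {Sign.+} {Sign.+} _   = refl

HasSign-corner : ∀ s {x y} → x ≈ corner s → 0ℝ < y × y < 1ℝ → HasSign s (x - y)
HasSign-corner Sign.- x≈0 (0<y , _) = HasSign-resp-≈ Sign.- (-‿congˡ (≈-sym x≈0)) (HasSign-sub-- 0<y)
HasSign-corner Sign.+ x≈1 (_ , y<1) = HasSign-resp-≈ Sign.+ (-‿congˡ (≈-sym x≈1)) (x<y⇒0<y-x y<1)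

-- The clause of `IsNash` for one player, with `l` in place of `Λ`.
BestReply : ℝ → ℝ → Set
BestReply x l = (0ℝ < x × x < 1ℝ → l ≈ 0ℝ) × (x ≈ 0ℝ → l ≤ 0ℝ) × (x ≈ 1ℝ → 0ℝ ≤ l)

indifferent⇒bestReply : ∀ {x l} → l ≈ 0ℝ → BestReply x l
indifferent⇒bestReply l≈0 = (λ _ → l≈0)
  , (λ _ 0<l → <⇒≉ 0<l (≈-sym l≈0))
  , (λ _ l<0 → <⇒≉ l<0 l≈0)

HasSign⇒bestReply : ∀ s {x l} → x ≈ corner s → HasSign s l → BestReply x l
HasSign⇒bestReply Sign.- x≈0 0<-l = (λ (0<x , _) → contradiction (≈-sym x≈0) (<⇒≉ 0<x))
  , (λ _ → 0<-x⇒x≤0 0<-l)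
  , (λ x≈1 → contradiction (≈-trans (≈-sym x≈0) x≈1) (<⇒≉ 0<1))
HasSign⇒bestReply Sign.+ x≈1 0<l = (λ (_ , x<1) → contradiction x≈1 (<⇒≉ x<1))
  , (λ x≈0 → contradiction (≈-trans (≈-sym x≈0) x≈1) (<⇒≉ 0<1))
  , (λ _ → <⇒≤ 0<l)

-- Together with `HasSign⇒bestReply`, this turns the equilibrium condition at a corner into an
-- equality of signs, provided that `l` has a definite sign.
bestReply⇒sign≡ : ∀ s t {x l} → x ≈ corner s → HasSign t l → BestReply x l → t ≡ s
bestReply⇒sign≡ Sign.- Sign.- _   _    _             = refl
bestReply⇒sign≡ Sign.- Sign.+ x≈0 0<l  (_ , l≤0 , _) = contradiction 0<l (l≤0 x≈0)
bestReply⇒sign≡ Sign.+ Sign.- x≈1 0<-l (_ , _ , 0≤l) = contradiction (0<-x⇒x<0 0<-l) (0≤l x≈1)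
bestReply⇒sign≡ Sign.+ Sign.+ _   _    _             = refl

-- Every sign is its own inverse, so the equation has a single solution; this gives the uniqueness
-- of the balancing sign at `i₀`.
[q*e]*w≡+⇒q≡e*w : ∀ q e w → (q Sign.* e) Sign.* w ≡ Sign.+ → q ≡ e Sign.* w
[q*e]*w≡+⇒q≡e*w q e w eq = Signₚ.*-cancelʳ-≡ (e Sign.* w) q (e Sign.* w)
  (trans (sym (Signₚ.*-assoc q e w)) (trans eq (sym (Signₚ.s*s≡+ (e Sign.* w)))))

[[e*w]*e]*w≡+ : ∀ e w → ((e Sign.* w) Sign.* e) Sign.* w ≡ Sign.+
[[e*w]*e]*w≡+ e w = trans (Signₚ.*-assoc (e Sign.* w) e w) (Signₚ.s*s≡+ (e Sign.* w))

-- Equilibria in `EC` for a permutation with a fixed point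

module Equilibria {m} (P : ProductGame m) (δ : Fin m → Permutation′ m)
  (isDelta : ∀ j → IsDelta j (δ j)) (isTuple : IsCharacteristicTuple P (λ _ → zero) δ)
  (π : Permutation′ m) (i₀ : Fin m) (i₀∈F : i₀ ∈F π) where

  open ProductGame P

  -- By `∏ˢ-crossing`, the product of crossings has this same value for every player `i`.
  W : Sign
  W = ∏ˢ (λ k → lt (π ⟨$⟩ʳ k) k)

  F? : ∀ k → Dec (k ∈F π)
  F? k = π ⟨$⟩ʳ k Finₚ.≟ k

  -- Signs at moved points are normalised to +, so that ∏ˢ t runs over the fixed points only.
  record _HasCorners_ (γ : Vector ℝ m) (t : Vector Sign m) : Set where
    field
      fixed : ∀ {k} → k ∈F π → γ k ≈ corner (t k)
      moved : ∀ {k} → ¬ k ∈F π → t k ≡ Sign.+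

  -- Associated permutations reverse the order of the thresholds: if `i` comes before `π k` under
  -- `δ k`, then `a i k` is the larger one and the difference is negative.
  HasSign-arc : ∀ {i k} → i ∈F π → ¬ k ∈F π →
                HasSign (crossing i k (π ⟨$⟩ʳ k)) (a (π ⟨$⟩ʳ k) k - a i k)
  HasSign-arc {i} {k} i∈F k∉F with crossingView {δ = δ k} (isDelta k) i≢k k∉F i≢πk
    where
    i≢k : i ≢ k
    i≢k refl = k∉F i∈F
    i≢πk : i ≢ π ⟨$⟩ʳ k
    i≢πk eq = i≢k (permutation-injective π (trans i∈F eq))
  ... | crosses δi<δp eq rewrite eq = HasSign-sub-- (to (proj₂ (proj₂ isTuple k) i _ (λ { refl → k∉F i∈F }) k∉F) δi<δp)
  ... | avoids  δp<δi eq rewrite eq = x<y⇒0<y-x (to (proj₂ (proj₂ isTuple k) _ i k∉F (λ { refl → k∉F i∈F })) δp<δi)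

  Λ-≈ : ∀ i {γ} → IsMixed γ → Λ game i γ ≈ ∏[j≢ i ] (λ j → γ j - a i j)
  Λ-≈ i {γ} mixed = ≈-trans
    (subst (λ s → Λ game i γ ≈ ([-1]^ s) * ∏[j≢ i ] (λ j → γ j - a i j)) (proj₁ isTuple i) (Λ-product i γ mixed))
    (*-identityˡ (∏[j≢ i ] (λ j → γ j - a i j)))

  HasSign-Λ : ∀ {γ t} → EC P π γ → γ HasCorners t → ∀ {i} → i ∈F π →
              HasSign (t i Sign.* (∏ˢ t Sign.* W)) (Λ game i γ)
  HasSign-Λ {γ} {t} (mixed , _ , γ≈a) γt {i} i∈F =
    HasSign-resp-≈ (t i Sign.* (∏ˢ t Sign.* W)) (≈-sym (Λ-≈ i mixed))
      (subst (λ s → HasSign s (∏[j≢ i ] (λ j → γ j - a i j))) ∏s≡ (HasSign-∏ {s = s} factor))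
    where
    open _HasCorners_ γt
    c s : Vector Sign m
    c k = crossing i k (π ⟨$⟩ʳ k)
    -- The factor at `k = i` is 1, so `at i (t i)` cancels `t i` there. In exchange, an extra `t i`
    -- stands in front of the full product.
    s k = at i (t i) k Sign.* (t k Sign.* c k)
    ∏s≡ : ∏ˢ s ≡ t i Sign.* (∏ˢ t Sign.* W)
    ∏s≡ = trans (∏ˢ-distrib-* (at i (t i)) (λ k → t k Sign.* c k))
      (cong₂ Sign._*_ (∏ˢ-at i (t i)) (trans (∏ˢ-distrib-* t c) (cong (∏ˢ t Sign.*_) (∏ˢ-crossing π i))))
    c-fixed : ∀ {k} → k ∈F π → c k ≡ Sign.+
    c-fixed {k} k∈F = trans (cong (crossing i k) k∈F) (crossing-loop i k)
    factor : ∀ k → HasSign (s k) (if does (k Finₚ.≟ i) then 1ℝ else (γ k - a i k))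
    factor k with k Finₚ.≟ i
    ... | yes refl rewrite c-fixed i∈F | Signₚ.*-identityʳ (t i) | Signₚ.s*s≡+ (t i) = 0<1
    ... | no k≢i with F? k
    ...   | yes k∈F rewrite c-fixed k∈F | Signₚ.*-identityʳ (t k) =
      HasSign-corner (t k) (fixed k∈F) (a∈⟨0,1⟩ i k (k≢i ∘ sym))
    ...   | no k∉F rewrite moved k∉F =
      HasSign-resp-≈ (c k) (-‿congˡ (≈-sym (γ≈a k k∉F))) (HasSign-arc i∈F k∉F)

  Λ-moved : ∀ {γ} → EC P π γ → ∀ {i} → ¬ i ∈F π → Λ game i γ ≈ 0ℝ
  Λ-moved {γ} (mixed , _ , γ≈a) {i} i∉F = ≈-trans (Λ-≈ i mixed) (∏-zero _ k factor)
    where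
    k : Fin m
    -- The player that `π` sends to `i` is moved as well, so membership in `EC` puts `γ k` at the
    -- threshold `a i k`.
    k = π ⟨$⟩ˡ i
    πk≡i : π ⟨$⟩ʳ k ≡ i
    πk≡i = inverseʳ π
    k≢i : k ≢ i
    k≢i k≡i = i∉F (subst (λ x → π ⟨$⟩ʳ x ≡ i) k≡i πk≡i)
    factor : (if does (k Finₚ.≟ i) then 1ℝ else (γ k - a i k)) ≈ 0ℝ
    factor rewrite dec-false (k Finₚ.≟ i) k≢i =
      x≈y⇒x-y≈0 (subst (λ x → γ k ≈ a x k) πk≡i (γ≈a k (λ k∈F → k≢i (trans (sym k∈F) πk≡i))))

  -- With common sign +, `Λ` at each fixed player has the sign of that player's own corner, while
  -- moved players are indifferent.
  isNash : ∀ {γ t} → EC P π γ → γ HasCorners t → ∏ˢ t Sign.* W ≡ Sign.+ → IsNash game γ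
  isNash {γ} {t} γ∈EC γt ∏t*W≡+ = proj₁ γ∈EC , reply
    where
    open _HasCorners_ γt
    reply : ∀ i → BestReply (γ i) (Λ game i γ)
    reply i with F? i
    ... | yes i∈F = HasSign⇒bestReply (t i) (fixed i∈F)
      (subst (λ s → HasSign s (Λ game i γ)) (trans (cong (t i Sign.*_) ∏t*W≡+) (Signₚ.*-identityʳ (t i)))
        (HasSign-Λ γ∈EC γt i∈F))
    ... | no i∉F = indifferent⇒bestReply (Λ-moved γ∈EC i∉F)

  -- The condition at `i₀` already decides: it equates `t i₀` with the sign of `Λ`, and cancelling
  -- `t i₀` leaves the common sign.
  isNash⁻¹ : ∀ {γ t} → EC P π γ → γ HasCorners t → IsNash game γ → ∏ˢ t Sign.* W ≡ Sign.+
  isNash⁻¹ {γ} {t} γ∈EC γt (_ , reply) = Signₚ.*-cancelˡ-≡ (t i₀) (∏ˢ t Sign.* W) Sign.+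
    (trans (bestReply⇒sign≡ (t i₀) _ (_HasCorners_.fixed γt i₀∈F) (HasSign-Λ γ∈EC γt i₀∈F) (reply i₀))
      (sym (Signₚ.*-identityʳ (t i₀))))

  profile : Vector Sign m → Vector ℝ m
  profile t k = if does (F? k) then corner (t k) else a (π ⟨$⟩ʳ k) k

  profile-fixed : ∀ t {k} → k ∈F π → profile t k ≡ corner (t k)
  profile-fixed t {k} k∈F rewrite dec-true (F? k) k∈F = refl

  profile-moved : ∀ t {k} → ¬ k ∈F π → profile t k ≡ a (π ⟨$⟩ʳ k) k
  profile-moved t {k} k∉F rewrite dec-false (F? k) k∉F = refl

  profile∈EC : ∀ t → EC P π (profile t)
  profile∈EC t = mixed , (λ i → mk⇔ (L⇒F i) (F⇒L i)) , λ j j∉F → ≡⇒≈ (profile-moved t j∉F)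
    where
    mixed : IsMixed (profile t)
    mixed k with F? k
    ... | yes _  = corner-∈[0,1] (t k)
    ... | no k∉F = let 0<a , a<1 = a∈⟨0,1⟩ (π ⟨$⟩ʳ k) k k∉F in <⇒≤ 0<a , <⇒≤ a<1
    L⇒F : ∀ k → k ∈L profile t → k ∈F π
    L⇒F k k∈L with F? k | k∈L
    ... | yes k∈F | _ = k∈F
    -- Thresholds lie strictly between 0 and 1, so a moved coordinate is never a corner.
    ... | no k∉F | inj₁ a≈0 = contradiction (≈-sym a≈0) (<⇒≉ (proj₁ (a∈⟨0,1⟩ (π ⟨$⟩ʳ k) k k∉F)))
    ... | no k∉F | inj₂ a≈1 = contradiction a≈1 (<⇒≉ (proj₂ (a∈⟨0,1⟩ (π ⟨$⟩ʳ k) k k∉F)))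
    F⇒L : ∀ k → k ∈F π → k ∈L profile t
    F⇒L k k∈F rewrite profile-fixed t k∈F = corner-∈L (t k) ≈-refl

  profile-injective : ∀ t u → (∀ k → profile t k ≈ profile u k) → ∀ {k} → k ∈F π → t k ≡ u k
  profile-injective t u eq {k} k∈F =
    corner-injective (subst₂ _≈_ (profile-fixed t k∈F) (profile-fixed u k∈F) (eq k))

  profile-≈ : ∀ {γ} t → EC P π γ → γ HasCorners t → ∀ k → profile t k ≈ γ k
  profile-≈ t (_ , _ , γ≈a) γt k with F? k
  ... | yes k∈F = ≈-sym (_HasCorners_.fixed γt k∈F)
  ... | no k∉F  = ≈-sym (γ≈a k k∉F)

  cornerSign : ∀ {x} → x ≈ 0ℝ ⊎ x ≈ 1ℝ → ∃[ s ] x ≈ corner s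
  cornerSign (inj₁ γ≈0) = Sign.- , γ≈0
  cornerSign (inj₂ γ≈1) = Sign.+ , γ≈1

  cornerSigns : ∀ {γ} → EC P π γ → ∃[ b ] (∀ {k} → k ∈F π → γ k ≈ corner (b k))
  cornerSigns {γ} (_ , L⇔F , _) = (λ k → proj₁ (choose k)) , λ {k} → proj₂ (choose k)
    where
    choose : ∀ k → ∃[ s ] (k ∈F π → γ k ≈ corner s)
    choose k with F? k
    ... | yes k∈F = let s , eq = cornerSign (from (L⇔F k) k∈F) in s , λ _ → eq
    -- A default value: the claim is vacuous at moved players.
    ... | no k∉F  = Sign.+ , λ k∈F → contradiction k∈F k∉F

  -- The fixed points whose corners are chosen freely; in an equilibrium they determine the corner
  -- at `i₀`.
  Free : Pred (Fin m) 0ℓ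
  Free k = k ∈F π × k ≢ i₀

  open SignVectors (signVectors {D = Free} (λ k → F? k ×-dec ¬? (k Finₚ.≟ i₀))) public

  -- `vector r` is + at `i₀`, which is not `Free`, so the multiplication sets that entry to `q` and
  -- keeps all others.
  signs : Sign → Fin count → Vector Sign m
  signs q r k = at i₀ q k Sign.* vector r k

  signs-i₀ : ∀ q r → signs q r i₀ ≡ q
  signs-i₀ q r = trans (cong₂ Sign._*_ (at-≡ i₀ q) (off r (λ (_ , i₀≢i₀) → i₀≢i₀ refl))) (Signₚ.*-identityʳ q)

  signs-≢ : ∀ q r {k} → k ≢ i₀ → signs q r k ≡ vector r k
  signs-≢ q r {k} k≢i₀ = cong (Sign._* vector r k) (at-≢ q k≢i₀)

  signs-moved : ∀ q r {k} → ¬ k ∈F π → signs q r k ≡ Sign.+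
  signs-moved q r k∉F = trans (signs-≢ q r λ { refl → k∉F i₀∈F }) (off r (k∉F ∘ proj₁))

  ∏ˢ-signs : ∀ q r → ∏ˢ (signs q r) ≡ q Sign.* ∏ˢ (vector r)
  ∏ˢ-signs q r = trans (∏ˢ-distrib-* (at i₀ q) (vector r)) (cong (Sign._* ∏ˢ (vector r)) (∏ˢ-at i₀ q))

  profile-HasCorners : ∀ q r → profile (signs q r) HasCorners signs q r
  profile-HasCorners q r = record
    { fixed = λ k∈F → ≡⇒≈ (profile-fixed (signs q r) k∈F)
    ; moved = signs-moved q r
    }

  signs-injective : ∀ q r q′ r′ → (∀ k → profile (signs q r) k ≈ profile (signs q′ r′) k) →
                    q ≡ q′ × r ≡ r′
  signs-injective q r q′ r′ eq =
      trans (sym (signs-i₀ q r)) (trans (profile-injective (signs q r) (signs q′ r′) eq i₀∈F) (signs-i₀ q′ r′))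
    , injective λ k (k∈F , k≢i₀) →
        trans (sym (signs-≢ q r k≢i₀)) (trans (profile-injective (signs q r) (signs q′ r′) eq k∈F) (signs-≢ q′ r′ k≢i₀))

  signs-surjective : ∀ {γ} → EC P π γ → ∃[ q ] ∃[ r ] γ HasCorners signs q r
  signs-surjective {γ} γ∈EC with cornerSigns γ∈EC
  ... | b , γ≈b with surjective b
  ...   | r , vector≡b = b i₀ , r , record
    { fixed = λ {k} k∈F → subst (λ s → γ k ≈ corner s) (sym (signs≡b k k∈F)) (γ≈b k∈F)
    ; moved = signs-moved (b i₀) r
    }
    where
    signs≡b : ∀ k → k ∈F π → signs (b i₀) r k ≡ b k
    signs≡b k k∈F with k Finₚ.≟ i₀
    ... | yes refl = trans (cong (b i₀ Sign.*_) (off r (λ (_ , i₀≢i₀) → i₀≢i₀ refl))) (Signₚ.*-identityʳ (b i₀))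
    ... | no k≢i₀  = vector≡b k (k∈F , k≢i₀)

  -- A point amounts to a sign at `i₀` together with signs at the other fixed points.
  EC-cardinality : HasCardinality (EC P π) (2 ℕ.* count)
  EC-cardinality = hasCardinality
    (λ x → profile (signs (proj₁ (unpair count x)) (proj₂ (unpair count x))))
    (λ x → profile∈EC (signs (proj₁ (unpair count x)) (proj₂ (unpair count x))))
    (λ {x} {y} eq → let q≡ , r≡ = signs-injective (proj₁ (unpair count x)) (proj₂ (unpair count x))
                                    (proj₁ (unpair count y)) (proj₂ (unpair count y)) eq
                    in unpair-injective count q≡ r≡)
    λ γ γ∈EC → let q , r , γt = signs-surjective γ∈EC
                   x , x≡   = unpair-surjective count q r
               in x , subst (λ z → ∀ k → profile (signs (proj₁ z) (proj₂ z)) k ≈ γ k) (sym x≡) (profile-≈ (signs q r) γ∈EC γt)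

  -- The sign at i₀ that makes the whole choice of signs an equilibrium.
  balance : Fin count → Sign
  balance r = ∏ˢ (vector r) Sign.* W

  -- Each choice of the free signs extends to exactly one equilibrium, the one with the balancing
  -- sign at `i₀`.
  EC∩Nash-cardinality : HasCardinality (EC P π ∩ IsNash game) count
  EC∩Nash-cardinality = hasCardinality
    (λ r → profile (signs (balance r) r))
    (λ r → profile∈EC (signs (balance r) r) , isNash (profile∈EC (signs (balance r) r)) (profile-HasCorners (balance r) r)
      (trans (cong (Sign._* W) (∏ˢ-signs (balance r) r)) ([[e*w]*e]*w≡+ (∏ˢ (vector r)) W)))
    (λ {r} {r′} eq → proj₂ (signs-injective (balance r) r (balance r′) r′ eq))
    λ γ (γ∈EC , nash) →
      let q , r , γt = signs-surjective γ∈EC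
          q≡ = [q*e]*w≡+⇒q≡e*w q (∏ˢ (vector r)) W
                 (trans (cong (Sign._* W) (sym (∏ˢ-signs q r))) (isNash⁻¹ γ∈EC γt nash))
      in r , profile-≈ (signs (balance r) r) γ∈EC (subst (λ q → γ HasCorners signs q r) q≡ γt)

isMaximal : ∀ {m} (P : ProductGame m) (δ : Fin m → Permutation′ m) →
            (∀ j → IsDelta j (δ j)) → IsCharacteristicTuple P (λ _ → zero) δ → IsMaximal P
-- The hypothesis on `π` is a bare negation; a finite search turns it into an actual fixed point.
isMaximal P δ isDelta isTuple π π∉Der with Finₚ.any? (λ i → π ⟨$⟩ʳ i Finₚ.≟ i)
... | no ∄ = contradiction (λ i i∈F → ∄ (i , i∈F)) π∉Der
... | yes (i₀ , i₀∈F) = count , EC-cardinality , EC∩Nash-cardinality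
  where
  open Equilibria P δ isDelta isTuple π i₀ i₀∈F

-- Existence

-- The identities behind the construction hold term by term, so they are checked on rational
-- sequences, where equality is exact.
seq-∏ : ∀ {m} (f : Vector ℝ m) n → seq (∏ f) n ≡ ∏ℚ (λ k → seq (f k) n)
seq-∏ {zero}  f n = seq-fromℚ 1ℚ n
seq-∏ {suc m} f n = trans (seq-* (f zero) (∏ (f ∘ suc)) n) (cong (seq (f zero) n ℚ.*_) (seq-∏ (f ∘ suc) n))

∏ℚ-zero : ∀ {m} (f : Vector ℚ m) i → f i ≡ 0ℚ → ∏ℚ f ≡ 0ℚ
∏ℚ-zero f zero    f0≡0 = trans (cong (ℚ._* ∏ℚ (f ∘ suc)) f0≡0) (ℚₚ.*-zeroˡ (∏ℚ (f ∘ suc)))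
∏ℚ-zero f (suc i) fi≡0 = trans (cong (f zero ℚ.*_) (∏ℚ-zero (f ∘ suc) i fi≡0)) (ℚₚ.*-zeroʳ (f zero))

∑ℚ : ∀ {m} → (PureProfile m → ℚ) → ℚ
∑ℚ {zero}  f = f []
∑ℚ {suc m} f = ∑ℚ (f ∘ (zero ∷_)) ℚ.+ ∑ℚ (f ∘ (suc zero ∷_))

∑ℚ-cong : ∀ {m} {f g : PureProfile m → ℚ} → (∀ s → f s ≡ g s) → ∑ℚ f ≡ ∑ℚ g
∑ℚ-cong {zero}  f≗g = f≗g []
∑ℚ-cong {suc m} f≗g = cong₂ ℚ._+_ (∑ℚ-cong (f≗g ∘ (zero ∷_))) (∑ℚ-cong (f≗g ∘ (suc zero ∷_)))

*-distribˡ-∑ℚ : ∀ {m} c (f : PureProfile m → ℚ) → ∑ℚ (λ s → c ℚ.* f s) ≡ c ℚ.* ∑ℚ f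
*-distribˡ-∑ℚ {zero}  c f = refl
*-distribˡ-∑ℚ {suc m} c f = trans
  (cong₂ ℚ._+_ (*-distribˡ-∑ℚ c (f ∘ (zero ∷_))) (*-distribˡ-∑ℚ c (f ∘ (suc zero ∷_))))
  (sym (ℚₚ.*-distribˡ-+ c (∑ℚ (f ∘ (zero ∷_))) (∑ℚ (f ∘ (suc zero ∷_)))))

-- The distributive law: expanding a product of two-term sums yields one term per pure profile. It
-- collapses a multilinear extension into a product.
∑ℚ-∏ℚ : ∀ {m} (h : Fin m → Fin 2 → ℚ) →
        ∑ℚ (λ s → ∏ℚ (λ k → h k (lookup s k))) ≡ ∏ℚ (λ k → h k zero ℚ.+ h k (suc zero))
∑ℚ-∏ℚ {zero}  h = refl
∑ℚ-∏ℚ {suc m} h = trans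
  (cong₂ ℚ._+_ (*-distribˡ-∑ℚ (h zero zero) rest) (*-distribˡ-∑ℚ (h zero (suc zero)) rest))
  (trans (sym (ℚₚ.*-distribʳ-+ (∑ℚ rest) (h zero zero) (h zero (suc zero))))
    (cong ((h zero zero ℚ.+ h zero (suc zero)) ℚ.*_) (∑ℚ-∏ℚ (h ∘ suc))))
  where
  rest : PureProfile m → ℚ
  rest s = ∏ℚ (λ k → h (suc k) (lookup s k))

seq-∑Profiles : ∀ {m} (f : PureProfile m → ℝ) n → seq (∑Profiles f) n ≡ ∑ℚ (λ s → seq (f s) n)
seq-∑Profiles {zero}  f n = refl
seq-∑Profiles {suc m} f n = trans
  (seq-+ (∑Profiles (f ∘ (zero ∷_))) (∑Profiles (f ∘ (suc zero ∷_))) n)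
  (cong₂ ℚ._+_ (seq-∑Profiles (f ∘ (zero ∷_)) n) (seq-∑Profiles (f ∘ (suc zero ∷_)) n))

-- Games with prescribed thresholds

module Construction {m} (a : Fin m → Fin m → ℝ) where

  -- Player `i`'s own factor is `x` itself, so the product vanishes at `γ i = 0` and reduces to the
  -- other players' factors at `γ i = 1`.
  factor : Fin m → Fin m → ℝ → ℝ
  factor i j x = if does (j Finₚ.≟ i) then x else x - a i j

  pure : Fin 2 → ℝ
  pure zero       = 0ℝ
  pure (suc zero) = 1ℝ

  productGame : TwoActionGame m
  productGame = record { U = λ i s → ∏ (λ j → factor i j (pure (lookup s j))) }

  -- Each factor is affine in x, so the multilinear extension of a product of factors is that product.
  factor-affine : ∀ i j x n →
    seq (prob x zero) n ℚ.* seq (factor i j (pure zero)) n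
      ℚ.+ seq (prob x (suc zero)) n ℚ.* seq (factor i j (pure (suc zero))) n
    ≡ seq (factor i j x) n
  factor-affine i j x n with j Finₚ.≟ i
  ... | yes _ rewrite seq-- 1ℝ x n | seq-fromℚ 0ℚ n | seq-fromℚ 1ℚ n =
    solve 1 (λ x → (con 1ℚ :- x) :* con 0ℚ :+ x :* con 1ℚ := x) refl (seq x n)
    where open +-*-Solver
  ... | no _ rewrite seq-- 1ℝ x n | seq-- 0ℝ (a i j) n | seq-- 1ℝ (a i j) n | seq-- x (a i j) n
                   | seq-fromℚ 0ℚ n | seq-fromℚ 1ℚ n =
    solve 2 (λ x a → (con 1ℚ :- x) :* (con 0ℚ :- a) :+ x :* (con 1ℚ :- a) := x :- a) refl (seq x n) (seq (a i j) n)
    where open +-*-Solver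

  seq-V : ∀ i γ n → seq (V productGame i γ) n ≡ ∏ℚ (λ j → seq (factor i j (γ j)) n)
  seq-V i γ n = begin
    seq (V productGame i γ) n
      ≡⟨ seq-∑Profiles (λ s → p s * u s) n ⟩
    ∑ℚ (λ s → seq (p s * u s) n)
      ≡⟨ ∑ℚ-cong (λ s → trans (seq-* (p s) (u s) n)
           (trans (cong₂ ℚ._*_ (seq-∏ (λ k → prob (γ k) (lookup s k)) n) (seq-∏ (λ k → factor i k (pure (lookup s k))) n))
             (sym (∏ℚ-distrib-* (λ k → seq (prob (γ k) (lookup s k)) n) (λ k → seq (factor i k (pure (lookup s k))) n))))) ⟩
    ∑ℚ (λ s → ∏ℚ (λ k → h k (lookup s k)))
      ≡⟨ ∑ℚ-∏ℚ h ⟩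
    ∏ℚ (λ k → h k zero ℚ.+ h k (suc zero))
      ≡⟨ ∏ℚ-cong (λ k → factor-affine i k (γ k) n) ⟩
    ∏ℚ (λ j → seq (factor i j (γ j)) n) ∎
    where
    open ≡-Reasoning
    p u : PureProfile m → ℝ
    p s = ∏ (λ k → prob (γ k) (lookup s k))
    u s = ∏ (λ k → factor i k (pure (lookup s k)))
    h : Fin m → Fin 2 → ℚ
    h k b = seq (prob (γ k) b) n ℚ.* seq (factor i k (pure b)) n

  Λ-productGame : ∀ i γ → Λ productGame i γ ≈ 1ℝ * ∏[j≢ i ] (λ j → γ j - a i j)
  Λ-productGame i γ = ≈-trans (seq-≈ λ n → begin
    seq (V productGame i γ₁ - V productGame i γ₀) n
      ≡⟨ seq-- (V productGame i γ₁) (V productGame i γ₀) n ⟩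
    seq (V productGame i γ₁) n ℚ.- seq (V productGame i γ₀) n
      ≡⟨ cong₂ ℚ._-_ (trans (seq-V i γ₁ n) (∏ℚ-cong (λ j → cong (λ x → seq x n) (factor₁ j))))
           (trans (seq-V i γ₀ n) (∏ℚ-zero _ i (trans (cong (λ x → seq x n) factor₀) (seq-fromℚ 0ℚ n)))) ⟩
    ∏ℚ (λ j → seq (if does (j Finₚ.≟ i) then 1ℝ else (γ j - a i j)) n) ℚ.- 0ℚ
      ≡⟨ ℚₚ.+-identityʳ _ ⟩
    ∏ℚ (λ j → seq (if does (j Finₚ.≟ i) then 1ℝ else (γ j - a i j)) n)
      ≡⟨ sym (seq-∏ (λ j → if does (j Finₚ.≟ i) then 1ℝ else (γ j - a i j)) n) ⟩
    seq (∏[j≢ i ] (λ j → γ j - a i j)) n ∎)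
    (≈-sym (*-identityˡ (∏[j≢ i ] (λ j → γ j - a i j))))
    where
    open ≡-Reasoning
    γ₁ γ₀ : Vector ℝ m
    γ₁ = updateAt γ i (const 1ℝ)
    γ₀ = updateAt γ i (const 0ℝ)
    factor₁ : ∀ j → factor i j (γ₁ j) ≡ (if does (j Finₚ.≟ i) then 1ℝ else (γ j - a i j))
    factor₁ j with j Finₚ.≟ i
    ... | yes refl = updateAt-updates i γ
    ... | no j≢i   = cong (_- a i j) (updateAt-minimal j i γ j≢i)
    factor₀ : factor i i (γ₀ i) ≡ 0ℝ
    factor₀ rewrite dec-true (i Finₚ.≟ i) refl = updateAt-updates i γ

-- Decreasing thresholds

halfPower : ℕ → ℚ
-- Starting at ½ rather than 1 keeps every value strictly inside the unit interval.
halfPower zero    = ½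
halfPower (suc d) = halfPower d ℚ.* ½

0<halfPower : ∀ d → 0ℚ ℚ.< halfPower d
0<halfPower zero    = ℚₚ.positive⁻¹ ½
0<halfPower (suc d) = CauchyLemmas.half-pos (0<halfPower d)

halfPower-suc : ∀ d → halfPower (suc d) ℚ.< halfPower d
halfPower-suc d = subst₂ ℚ._<_ (ℚₚ.+-identityʳ (halfPower (suc d))) (CauchyLemmas.halves (halfPower d))
  (ℚₚ.+-monoʳ-< (halfPower (suc d)) (0<halfPower (suc d)))

halfPower-anti : ∀ {d e} → d ℕ.< e → halfPower e ℚ.< halfPower d
halfPower-anti {d} {suc e} (ℕ.s≤s d≤e) with ℕₚ.m≤n⇒m<n∨m≡n d≤e
... | inj₁ d<e  = ℚₚ.<-trans (halfPower-suc e) (halfPower-anti d<e)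
... | inj₂ refl = halfPower-suc d

halfPower<1 : ∀ d → halfPower d ℚ.< 1ℚ
halfPower<1 zero    = ℚ.*<* (ℤ.+<+ (ℕ.s≤s (ℕ.s≤s ℕ.z≤n)))
halfPower<1 (suc d) = ℚₚ.<-trans (halfPower-suc d) (halfPower<1 d)

-- Construction of the permutations `delta`

blockSwap : ∀ p q → Permutation (p ℕ.+ q) (q ℕ.+ p)
blockSwap p q = ↔-sym (Finₚ.+↔⊎ {q} {p}) ↔-∘ (⊎-comm (Fin p) (Fin q) ↔-∘ Finₚ.+↔⊎ {p} {q})

-- x ↦ y is the rotation of {0, …, p + q − 1} that sends p to 0.
data Rotated (p q x y : ℕ) : Set where
  low  : x ℕ.< p → y ≡ q ℕ.+ x → Rotated p q x y
  high : y ℕ.< q → x ≡ p ℕ.+ y → Rotated p q x y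

blockSwap-rotated : ∀ p q x → Rotated p q (toℕ x) (toℕ (blockSwap p q ⟨$⟩ʳ x))
blockSwap-rotated p q x with Fin.splitAt p x in eq
... | inj₁ y rewrite sym (Finₚ.splitAt⁻¹-↑ˡ eq) | Finₚ.toℕ-↑ˡ y q = low (Finₚ.toℕ<n y) (Finₚ.toℕ-↑ʳ q y)
... | inj₂ y rewrite sym (Finₚ.splitAt⁻¹-↑ʳ {p} eq) | Finₚ.toℕ-↑ʳ p y | Finₚ.toℕ-↑ˡ y p = high (Finₚ.toℕ<n y) refl

-- With `j` deleted, the players below `j` form the initial block, which is moved behind the players
-- above `j`. The casts identify both block sums with `n`.
rotation : ∀ {n} → Fin (suc n) → Permutation′ n
rotation {n} j = cast-id (sym eq) ∘ₚ blockSwap (toℕ j) (n ℕ.∸ toℕ j) ∘ₚ cast-id (trans (ℕₚ.+-comm _ (toℕ j)) eq)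
  where
  eq : toℕ j ℕ.+ (n ℕ.∸ toℕ j) ≡ n
  eq = ℕₚ.m+[n∸m]≡n (ℕ.s≤s⁻¹ (Finₚ.toℕ<n j))

rotation-rotated : ∀ {n} (j : Fin (suc n)) x → Rotated (toℕ j) (n ℕ.∸ toℕ j) (toℕ x) (toℕ (rotation j ⟨$⟩ʳ x))
rotation-rotated {n} j x = subst₂ (Rotated (toℕ j) (n ℕ.∸ toℕ j))
  (Finₚ.toℕ-cast _ x) (sym (Finₚ.toℕ-cast _ _))
  (blockSwap-rotated (toℕ j) (n ℕ.∸ toℕ j) _)

-- Order is kept inside each block and the two blocks trade places, so only pairs straddling `p` are
-- inverted.
Rotated-desc : ∀ {p q x x′ y y′} → Rotated p q x x′ → Rotated p q y y′ → x ℕ.< y →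
               (y′ ℕ.< x′ → x ℕ.< p × p ℕ.≤ y) × (x ℕ.< p → p ℕ.≤ y → y′ ℕ.< x′)
Rotated-desc {p} {q} {x} {y = y} (low x<p refl) (low y<p refl) x<y =
    (λ y′<x′ → contradiction y′<x′ (ℕₚ.<⇒≯ (ℕₚ.+-monoʳ-< q x<y)))
  , (λ _ p≤y → contradiction y<p (ℕₚ.≤⇒≯ p≤y))
Rotated-desc {p} {q} {x} {y′ = y′} (low x<p refl) (high y′<q refl) x<y =
    (λ _ → x<p , ℕₚ.m≤m+n p y′)
  , (λ _ _ → ℕₚ.<-≤-trans y′<q (ℕₚ.m≤m+n q x))
Rotated-desc {p} {x′ = x′} (high _ refl) (low y<p refl) x<y =
  contradiction (ℕₚ.≤-<-trans (ℕₚ.m≤m+n p x′) x<y) (ℕₚ.<⇒≯ y<p)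
Rotated-desc {p} {x′ = x′} (high _ refl) (high _ refl) x<y =
    (λ y′<x′ → contradiction (ℕₚ.+-cancelˡ-< p _ _ x<y) (ℕₚ.<⇒≯ y′<x′))
  , (λ x<p _ → contradiction x<p (ℕₚ.≤⇒≯ (ℕₚ.m≤m+n p x′)))

punchIn-cancel-< : ∀ {n} j (x y : Fin n) → punchIn j x Fin.< punchIn j y → x Fin.< y
punchIn-cancel-< j x y lt = ℕₚ.≰⇒> λ y≤x → ℕₚ.<⇒≱ lt (Finₚ.punchIn-mono-≤ j y x y≤x)

punchIn-mono-< : ∀ {n} j (x y : Fin n) → x Fin.< y → punchIn j x Fin.< punchIn j y
punchIn-mono-< j x y x<y = ℕₚ.≰⇒> λ le → ℕₚ.<⇒≱ x<y (Finₚ.punchIn-cancel-≤ j y x le)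

-- With `punchIn-above`, translates the block boundary into lying below or above `j` once `j` is
-- reinserted.
punchIn-below : ∀ {n} j (x : Fin n) → toℕ x ℕ.< toℕ j → punchIn j x Fin.< j
punchIn-below (suc j) zero    _           = ℕ.s≤s ℕ.z≤n
punchIn-below (suc j) (suc x) (ℕ.s≤s x<j) = ℕ.s≤s (punchIn-below j x x<j)

punchIn-above : ∀ {n} j (x : Fin n) → toℕ j ℕ.≤ toℕ x → j Fin.< punchIn j x
punchIn-above zero    x       _           = ℕ.s≤s ℕ.z≤n
punchIn-above (suc j) (suc x) (ℕ.s≤s j≤x) = ℕ.s≤s (punchIn-above j x j≤x)

-- Opaque so that the type checker does not unfold insert and rotation inside the game.
opaque

  delta : ∀ {n} → Fin (suc n) → Permutation′ (suc n)
  delta j = insert j j (rotation j)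

  delta-self : ∀ {n} (j : Fin (suc n)) → delta j ⟨$⟩ʳ j ≡ j
  delta-self j with j Finₚ.≟ j
  ... | yes _  = refl
  ... | no j≢j = contradiction refl j≢j

  delta-punchIn : ∀ {n} (j : Fin (suc n)) x → delta j ⟨$⟩ʳ punchIn j x ≡ punchIn j (rotation j ⟨$⟩ʳ x)
  delta-punchIn j = insert-punchIn j j (rotation j)

delta-isDelta : ∀ {n} (j : Fin (suc n)) → IsDelta j (delta j)
delta-isDelta {n} j = delta-self j , λ k₁ k₂ k₁≢j k₂≢j →
  -- Every player other than `j` has the form `punchIn j x`, and on these `delta j` acts as the
  -- rotation.
  subst₂ (λ k₁ k₂ → k₁ Fin.< k₂ → delta j ⟨$⟩ʳ k₂ Fin.< delta j ⟨$⟩ʳ k₁ ⇔ (k₁ Fin.< j × j Fin.< k₂))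
    (Finₚ.punchIn-punchOut (k₁≢j ∘ sym)) (Finₚ.punchIn-punchOut (k₂≢j ∘ sym))
    (desc (punchOut (k₁≢j ∘ sym)) (punchOut (k₂≢j ∘ sym)))
  where
  desc : ∀ x y → punchIn j x Fin.< punchIn j y →
         delta j ⟨$⟩ʳ punchIn j y Fin.< delta j ⟨$⟩ʳ punchIn j x ⇔ (punchIn j x Fin.< j × j Fin.< punchIn j y)
  desc x y x<y = mk⇔
    (λ δy<δx →
      let x<j , j≤y = proj₁ rotated (punchIn-cancel-< j (rotation j ⟨$⟩ʳ y) (rotation j ⟨$⟩ʳ x)
                        (subst₂ Fin._<_ (delta-punchIn j y) (delta-punchIn j x) δy<δx))
      in punchIn-below j x x<j , punchIn-above j y j≤y)
    (λ (x<j , j<y) → subst₂ Fin._<_ (sym (delta-punchIn j y)) (sym (delta-punchIn j x))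
      (punchIn-mono-< j (rotation j ⟨$⟩ʳ y) (rotation j ⟨$⟩ʳ x) (proj₂ rotated
        -- `punchIn-below` and `punchIn-above` cover complementary cases, so each supplies the
        -- converse of the other by contradiction.
        (ℕₚ.≰⇒> λ j≤x → ℕₚ.<⇒≯ x<j (punchIn-above j x j≤x))
        (ℕₚ.≮⇒≥ λ y<j → ℕₚ.<⇒≯ j<y (punchIn-below j y y<j)))))
    where
    rotated = Rotated-desc (rotation-rotated j x) (rotation-rotated j y) (punchIn-cancel-< j x y x<y)

-- The game with characteristic permutations `delta`

deltaGame : ∀ n → ProductGame (suc n)
deltaGame n = record
  { game       = productGame
  ; v          = λ _ → zero
  ; a          = a
  ; a∈⟨0,1⟩    = λ i j _ → let d = toℕ (delta j ⟨$⟩ʳ i) in fromℚ-mono-< (0<halfPower d) , fromℚ-mono-< (halfPower<1 d)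
  ; a-distinct = λ i₁ i₂ j i₁≢i₂ _ _ → a-distinct i₁ i₂ j i₁≢i₂
  ; Λ-product  = λ i γ _ → Λ-productGame i γ
  }
  where
  a : Fin (suc n) → Fin (suc n) → ℝ
  -- `halfPower` is decreasing, which matches the reversed order in `IsAssociatedPermutation`.
  a i j = fromℚ (halfPower (toℕ (delta j ⟨$⟩ʳ i)))
  open Construction a
  a-distinct : ∀ i₁ i₂ j → i₁ ≢ i₂ → ¬ a i₁ j ≈ a i₂ j
  a-distinct i₁ i₂ j i₁≢i₂ eq with Finₚ.<-cmp (delta j ⟨$⟩ʳ i₁) (delta j ⟨$⟩ʳ i₂)
  ... | tri< lt _ _ = <⇒≉ (fromℚ-mono-< (halfPower-anti lt)) (≈-sym eq)
  ... | tri≈ _ δ≡ _ = i₁≢i₂ (permutation-injective (delta j) δ≡)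
  ... | tri> _ _ gt = <⇒≉ (fromℚ-mono-< (halfPower-anti gt)) eq

deltaGame-tuple : ∀ n → IsCharacteristicTuple (deltaGame n) (λ _ → zero) delta
deltaGame-tuple n = (λ _ → refl) , λ j → delta-self j , λ i i′ _ _ →
  mk⇔ (λ lt → fromℚ-mono-< (halfPower-anti lt)) (order j i i′)
  where
  open ProductGame (deltaGame n)
  order : ∀ j i i′ → a i′ j < a i j → delta j ⟨$⟩ʳ i Fin.< delta j ⟨$⟩ʳ i′
  order j i i′ a′<a with Finₚ.<-cmp (delta j ⟨$⟩ʳ i) (delta j ⟨$⟩ʳ i′)
  ... | tri< lt _ _ = lt
  ... | tri≈ _ δ≡ _ = contradiction (subst (λ x → fromℚ (halfPower (toℕ x)) < a i j) (sym δ≡) a′<a) <-irrefl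
  ... | tri> _ _ gt = contradiction a′<a (<⇒≤ (fromℚ-mono-< (halfPower-anti gt)))

theorem4p4 : (m : ℕ) → 1 ℕ.≤ m →
    ((P : ProductGame m) (δ : Fin m → Permutation′ m) →
    (∀ j → IsDelta j (δ j)) →
    IsCharacteristicTuple P (λ _ → zero) δ →
    IsMaximal P)
    × (∃[ P ] ∃[ δ ] ((∀ j → IsDelta {m} j (δ j)) × IsCharacteristicTuple P (λ _ → zero) δ))
theorem4p4 (suc n) _ = isMaximal , deltaGame n , delta , delta-isDelta , deltaGame-tuple n
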